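{- For $\ell\ge1$, let $\mathscr{A}$ be the toric arrangement in $(\mathbb{S}^1)^\ell$ consisting of the hypertori $\{t_i=1\}$ ($1\le i\le\ell$), $\{t_it_j=1\}$ and $\{t_it_j^{ -1}=1\}$ ($1\le i<j\le\ell$) (the arrangement of $\Phi^+(B_\ell)$ with respect to the integer lattice). Then $\mathscr{A}$ is supersolvable if and only if $\ell\le2$.
   Context: The poset of layers $L(\mathscr{A})$ consists of connected components of nonempty intersections of subsets of $\mathscr{A}$ (empty intersection $=(\mathbb{S}^1)^\ell$), ordered by reverse inclusion, with rank $=$ codimension; $\mathscr{A}$ is supersolvable if $L(\mathscr{A})$ is. For a finite ranked poset $\mathcal{P}$ with minimum $\hat0$ in which each $\mathcal{P}_{\le x}$ is a geometric lattice (a lattice where $y$ covers $x$ iff $y=x\vee a$ for some atom $a\not\le x$): $\bigvee T$ denotes the set of minimal upper bounds of $T$; an element $y$ of a geometric lattice $L$ is modular if $y\wedge(w\vee z)=(y\wedge w)\vee z$ for all $z\le y$, $w\in L$; an M-ideal of $\mathcal{P}$ is a pure (all maximal elements of equal rank), join-closed ($T\subseteq\mathcal{Q}\Rightarrow\bigvee T\subseteq\mathcal{Q}$) order ideal $\mathcal{Q}$ such that (1) every atom $a\notin\mathcal{Q}$ and $y\in\mathcal{Q}$ have at least one minimal upper bound, and (2) for every maximal $x\in\mathcal{P}$ some maximal $y\in\mathcal{Q}$ is modular in $\mathcal{P}_{\le x}$; $\mathcal{P}$ is supersolvable if there is a chain $\{\hat0\}=\mathcal{Q}_0\subsetneq\mathcal{Q}_1\subsetneq\cdots\subsetneq\mathcal{Q}_r=\mathcal{P}$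 with each $\mathcal{Q}_i$ an M-ideal of $\mathcal{Q}_{i+1}$ and $\operatorname{rk}(\mathcal{Q}_i)=i$. -}

module Defs where

open import Data.Fin.Base as Fin using (Fin; inject₁; fromℕ; toℕ)
open import Data.Integer.Base using (ℤ)
open import Data.List.Base using (List; length)
open import Data.List.Relation.Unary.Linked using (Linked)
open import Data.Nat.Base as ℕ using (ℕ; suc)
import Data.Nat.Properties as ℕₚ
open import Data.Product.Base using (Σ; ∃-syntax; Σ-syntax; _×_; _,_; proj₁; proj₂)
open import Data.Rational.Base as ℚ using (ℚ; 0ℚ; ½)
import Data.Rational.Properties as ℚₚ
open import Data.Rational.Solver using (module +-*-Solver)
open import Data.Sum.Base using (_⊎_)
open import Function.Base using (_∘_)
open import Function.Bundles using (_⇔_)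
open import Level using (Level; _⊔_; 0ℓ) renaming (suc to lsuc)
open import Relation.Binary.Bundles using (Poset)
import Relation.Binary.Construct.On as On
open import Relation.Binary.Definitions using (Minimum)
open import Relation.Binary.Lattice.Structures using (IsLattice)
open import Relation.Binary.PropositionalEquality
  using (_≡_; refl; sym; trans; cong; subst)
import Relation.Binary.Properties.Poset as PosetProperties
open import Relation.Nullary.Negation.Core using (¬_)
open import Relation.Unary using (Pred; _∈_; _∉_; _⊆_; _⊂_; _∪_; U)
open import Relation.Unary.Relation.Binary.Subset using (⊆-poset)

------------------------------------------------------------------------
-- Real numbers: Cauchy sequences of rationals

IsCauchy : (ℕ → ℚ) → Set
IsCauchy x = ∀ ε → 0ℚ ℚ.< ε →
  ∃[ N ] ∀ m n → N ℕ.≤ m → N ℕ.≤ n → ℚ.∣ x m ℚ.- x n ∣ ℚ.< ε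

record ℝ : Set where
  constructor mkℝ
  field
    seq    : ℕ → ℚ
    cauchy : IsCauchy seq

open ℝ public

-- |x − y| < ε.  The rational δ makes the inequality strict in the limit.
Within : ℚ → ℝ → ℝ → Set
Within ε x y = ∃[ δ ] (δ ℚ.< ε) ×
  (∃[ N ] ∀ n → N ℕ.≤ n → ℚ.∣ seq x n ℚ.- seq y n ∣ ℚ.≤ δ)

infix 4 _≃_
_≃_ : ℝ → ℝ → Set
x ≃ y = ∀ ε → 0ℚ ℚ.< ε → Within ε x y

private
  halves : ∀ ε → ε ℚ.* ½ ℚ.+ ε ℚ.* ½ ≡ ε
  halves ε = trans (sym (ℚₚ.*-distribˡ-+ ε ½ ½)) (ℚₚ.*-identityʳ ε)

  half-pos : ∀ {ε} → 0ℚ ℚ.< ε → 0ℚ ℚ.< ε ℚ.* ½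
  half-pos {ε} 0<ε =
    subst (ℚ._< ε ℚ.* ½) (ℚₚ.*-zeroˡ ½) (ℚₚ.*-monoˡ-<-pos ½ 0<ε)

  +-interchange : ∀ a b c d →
    (a ℚ.+ b) ℚ.- (c ℚ.+ d) ≡ (a ℚ.- c) ℚ.+ (b ℚ.- d)
  +-interchange = solve 4
    (λ a b c d → (a :+ b) :- (c :+ d) := (a :- c) :+ (b :- d)) refl
    where open +-*-Solver

  neg-interchange : ∀ a b → (ℚ.- a) ℚ.- (ℚ.- b) ≡ ℚ.- (a ℚ.- b)
  neg-interchange = solve 2 (λ a b → (:- a) :- (:- b) := :- (a :- b)) refl
    where open +-*-Solver

  const-cauchy : ∀ q → IsCauchy (λ _ → q)
  const-cauchy q ε 0<ε = 0 , λ _ _ _ _ →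
    subst (ℚ._< ε) (sym (cong ℚ.∣_∣ (ℚₚ.+-inverseʳ q))) 0<ε

  +-cauchy : ∀ {x y} → IsCauchy x → IsCauchy y → IsCauchy (λ n → x n ℚ.+ y n)
  +-cauchy {x} {y} cx cy ε 0<ε
    with cx (ε ℚ.* ½) (half-pos 0<ε) | cy (ε ℚ.* ½) (half-pos 0<ε)
  ... | N₁ , p | N₂ , q = N₁ ℕ.⊔ N₂ , λ m n N≤m N≤n →
    let open ℚₚ.≤-Reasoning in begin-strict
      ℚ.∣ (x m ℚ.+ y m) ℚ.- (x n ℚ.+ y n) ∣
        ≡⟨ cong ℚ.∣_∣ (+-interchange (x m) (y m) (x n) (y n)) ⟩
      ℚ.∣ (x m ℚ.- x n) ℚ.+ (y m ℚ.- y n) ∣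
        ≤⟨ ℚₚ.∣p+q∣≤∣p∣+∣q∣ (x m ℚ.- x n) (y m ℚ.- y n) ⟩
      ℚ.∣ x m ℚ.- x n ∣ ℚ.+ ℚ.∣ y m ℚ.- y n ∣
        <⟨ ℚₚ.+-mono-< (p m n (ℕₚ.m⊔n≤o⇒m≤o N₁ N₂ N≤m) (ℕₚ.m⊔n≤o⇒m≤o N₁ N₂ N≤n))
                       (q m n (ℕₚ.m⊔n≤o⇒n≤o N₁ N₂ N≤m) (ℕₚ.m⊔n≤o⇒n≤o N₁ N₂ N≤n)) ⟩
      ε ℚ.* ½ ℚ.+ ε ℚ.* ½
        ≡⟨ halves ε ⟩
      ε ∎

  neg-cauchy : ∀ {x} → IsCauchy x → IsCauchy (λ n → ℚ.- x n)
  neg-cauchy {x} cx ε 0<ε with cx ε 0<ε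
  ... | N , p = N , λ m n N≤m N≤n →
    subst (ℚ._< ε)
      (sym (trans (cong ℚ.∣_∣ (neg-interchange (x m) (x n)))
                  (ℚₚ.∣-p∣≡∣p∣ (x m ℚ.- x n))))
      (p m n N≤m N≤n)

infixl 6 _+ᵣ_
_+ᵣ_ : ℝ → ℝ → ℝ
x +ᵣ y = mkℝ (λ n → seq x n ℚ.+ seq y n) (+-cauchy {seq x} {seq y} (cauchy x) (cauchy y))

-ᵣ_ : ℝ → ℝ
-ᵣ x = mkℝ (λ n → ℚ.- seq x n) (neg-cauchy {seq x} (cauchy x))

fromℚ : ℚ → ℝ
fromℚ q = mkℝ (λ _ → q) (const-cauchy q)

fromℤ : ℤ → ℝ
fromℤ k = fromℚ (k ℚ./ 1)

------------------------------------------------------------------------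
-- The circle group 𝕊¹ = ℝ/ℤ, written multiplicatively: the real number x
-- stands for the point exp(2πix).  Equality is congruence modulo ℤ.

𝕊¹ : Set
𝕊¹ = ℝ

infix  4 _≈₁_
infixl 7 _·_
infix  8 _⁻¹

_≈₁_ : 𝕊¹ → 𝕊¹ → Set
t ≈₁ s = ∃[ k ] t ≃ (s +ᵣ fromℤ k)

1₁ : 𝕊¹
1₁ = fromℚ 0ℚ

_·_ : 𝕊¹ → 𝕊¹ → 𝕊¹
_·_ = _+ᵣ_

_⁻¹ : 𝕊¹ → 𝕊¹
_⁻¹ = -ᵣ_

Near : ℚ → 𝕊¹ → 𝕊¹ → Set
Near ε t s = ∃[ k ] Within ε t (s +ᵣ fromℤ k)

Torus : ℕ → Set
Torus ℓ = Fin ℓ → 𝕊¹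

------------------------------------------------------------------------
-- Topology of the torus.  Balls are taken in the sup metric of the
-- arc-length metric on ℝ/ℤ; they induce the product topology.

module _ {ℓ : ℕ} where

  Ball : Torus ℓ → ℚ → Pred (Torus ℓ) 0ℓ
  Ball t ε s = ∀ i → Near ε (t i) (s i)

  Open : Pred (Torus ℓ) 0ℓ → Set
  Open A = ∀ t → t ∈ A → ∃[ ε ] (0ℚ ℚ.< ε) × (Ball t ε ⊆ A)

  -- Any two open sets that cover C and both meet C meet each other inside C.
  Connected : Pred (Torus ℓ) 0ℓ → Set₁
  Connected C = ∀ A B → Open A → Open B → C ⊆ A ∪ B →
    (∃[ t ] t ∈ C × t ∈ A) → (∃[ t ] t ∈ C × t ∈ B) →
    ∃[ t ] t ∈ C × t ∈ A × t ∈ B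

  -- A maximal set is automatically closed under pointwise _≈₁_ whenever S is,
  -- because open sets are; so subsets need not be required to respect _≈₁_.
  record IsConnectedComponent (S C : Pred (Torus ℓ) 0ℓ) : Set₁ where
    field
      nonempty  : ∃[ t ] t ∈ C
      contained : C ⊆ S
      connected : Connected C
      maximal   : ∀ (D : Pred (Torus ℓ) 0ℓ) → Connected D →
                  C ⊆ D → D ⊆ S → D ⊆ C

------------------------------------------------------------------------
-- Arrangements and posets of layers

Arrangement : Set → ℕ → Set₁
Arrangement I ℓ = I → Pred (Torus ℓ) 0ℓ

module _ {I : Set} {ℓ : ℕ} (𝒜 : Arrangement I ℓ) where

  Intersection : Pred I 0ℓ → Pred (Torus ℓ) 0ℓ
  Intersection T t = ∀ α → α ∈ T → t ∈ 𝒜 α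

  record Layer : Set₁ where
    field
      subset      : Pred I 0ℓ
      points      : Pred (Torus ℓ) 0ℓ
      isComponent : IsConnectedComponent (Intersection subset) points

  -- X ≤ Y means points Y ⊆ points X, and X ≈ Y means that X and Y have the
  -- same points (the chosen subset of I is irrelevant).
  layers : Poset (lsuc 0ℓ) 0ℓ 0ℓ
  layers = On.poset (PosetProperties.≥-poset (⊆-poset (Torus ℓ) 0ℓ)) Layer.points

-- Φ⁺(B_ℓ): εᵢ, and εᵢ + εⱼ, εᵢ − εⱼ for i < j.
data PositiveRootB (ℓ : ℕ) : Set where
  short : (i : Fin ℓ) → PositiveRootB ℓ
  plus  : (i j : Fin ℓ) → i Fin.< j → PositiveRootB ℓ
  minus : (i j : Fin ℓ) → i Fin.< j → PositiveRootB ℓ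

arrangementB : ∀ ℓ → Arrangement (PositiveRootB ℓ) ℓ
arrangementB ℓ (short i)     t = t i ≈₁ 1₁
arrangementB ℓ (plus  i j _) t = t i · t j ≈₁ 1₁
arrangementB ℓ (minus i j _) t = t i · (t j) ⁻¹ ≈₁ 1₁

------------------------------------------------------------------------
-- Order theory

private variable
  c ℓ₁ ℓ₂ a : Level

infixl 5 _↾_ _↓_

_↾_ : (P : Poset c ℓ₁ ℓ₂) → Pred (Poset.Carrier P) a → Poset (c ⊔ a) ℓ₁ ℓ₂
P ↾ Q = On.poset P (proj₁ {A = Poset.Carrier P} {B = Q})

_↓_ : (P : Poset c ℓ₁ ℓ₂) → Poset.Carrier P → Poset (c ⊔ ℓ₂) ℓ₁ ℓ₂
P ↓ x = P ↾ (λ y → Poset._≤_ P y x)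

-- Longest chains have n + 1 elements.  For ranked posets this is the rank of
-- the poset, and HasRank (P ↓ x) n says that x has rank n.
HasRank : Poset c ℓ₁ ℓ₂ → ℕ → Set (c ⊔ ℓ₁ ⊔ ℓ₂)
HasRank P n =
  (Σ[ xs ∈ List Carrier ] Linked _<_ xs × length xs ≡ suc n) ×
  (∀ xs → Linked _<_ xs → length xs ℕ.≤ suc n)
  where
  open Poset P using (Carrier)
  open PosetProperties P using (_<_)

record IsModular (L : Poset c ℓ₁ ℓ₂) (y : Poset.Carrier L) : Set (c ⊔ ℓ₁ ⊔ ℓ₂) where
  open Poset L using (Carrier; _≈_; _≤_)
  field
    _∨_ _∧_    : Carrier → Carrier → Carrier
    isLattice  : IsLattice _≈_ _≤_ _∨_ _∧_
    modularLaw : ∀ w z → z ≤ y → (y ∧ (w ∨ z)) ≈ ((y ∧ w) ∨ z)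

module _ (P : Poset c ℓ₁ ℓ₂) where

  open Poset P using (Carrier; _≈_; _≤_)
  open PosetProperties P using (_<_)

  IsMaximal : Pred Carrier a → Carrier → Set (c ⊔ a ⊔ ℓ₁ ⊔ ℓ₂)
  IsMaximal Q x = x ∈ Q × (∀ y → y ∈ Q → x ≤ y → y ≈ x)

  IsAtom : Carrier → Set (c ⊔ ℓ₁ ⊔ ℓ₂)
  IsAtom x = ∃[ o ] Minimum _≤_ o × o < x × (∀ y → o < y → ¬ (y < x))

  IsUpperBound : Pred Carrier a → Carrier → Set (c ⊔ a ⊔ ℓ₂)
  IsUpperBound T u = ∀ t → t ∈ T → t ≤ u

  -- u ∈ ⋁ T
  IsMinimalUpperBound : Pred Carrier a → Carrier → Set (c ⊔ a ⊔ ℓ₁ ⊔ ℓ₂)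
  IsMinimalUpperBound T u =
    IsUpperBound T u × (∀ v → IsUpperBound T v → v ≤ u → v ≈ u)

  record IsMIdeal (Q : Pred Carrier a) : Set (c ⊔ lsuc (a ⊔ ℓ₁ ⊔ ℓ₂)) where
    field
      downClosed : ∀ x y → y ∈ Q → x ≤ y → x ∈ Q
      pure       : ∃[ n ] (∀ x → IsMaximal Q x → HasRank (P ↓ x) n)
      joinClosed : ∀ (T : Pred Carrier (a ⊔ ℓ₁ ⊔ ℓ₂)) → T ⊆ Q →
                   ∀ u → IsMinimalUpperBound T u → u ∈ Q
      atomJoin   : ∀ x y → IsAtom x → x ∉ Q → y ∈ Q →
                   ∃[ u ] IsMinimalUpperBound (λ z → z ≈ x ⊎ z ≈ y) u
      modular    : ∀ x → IsMaximal U x →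
                   ∃[ y ] IsMaximal Q y ×
                   (Σ[ y≤x ∈ y ≤ x ] IsModular (P ↓ x) (y , y≤x))

-- The standing assumptions on P (finite, ranked, with minimum, every P ↓ x a
-- geometric lattice) are not repeated here; they hold for posets of layers.
record Supersolvable (P : Poset c ℓ₁ ℓ₂) : Set (lsuc (c ⊔ ℓ₁ ⊔ ℓ₂)) where
  open Poset P using (Carrier; _≤_)
  field
    r       : ℕ
    ideal   : Fin (suc r) → Pred Carrier (ℓ₁ ⊔ ℓ₂)
    bottom  : ∀ x → x ∈ ideal Fin.zero ⇔ Minimum _≤_ x
    top     : ∀ x → x ∈ ideal (fromℕ r)
    strict  : ∀ (i : Fin r) → ideal (inject₁ i) ⊂ ideal (Fin.suc i)
    mIdeal  : ∀ (i : Fin r) →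
              IsMIdeal (P ↾ ideal (Fin.suc i)) (ideal (inject₁ i) ∘ proj₁)
    rank    : ∀ i → HasRank (P ↾ ideal i) (toℕ i)

{-# OPTIONS --safe #-}

-- For ℓ ≤ 2 the poset of layers has height ≤ 2, so every interval below a layer is a lattice in
-- which all elements are modular; the chain {whole torus} ⊂ {whole torus, t₁t₂ = 1} ⊂ L consists
-- of M-ideals because every maximal layer lies on t₁t₂ = 1.
--
-- Let ℓ ≥ 3 and let Q be the last proper M-ideal, of corank one.  Below a maximal layer x there is
-- a modular y ∈ Q of corank one, and modularity forces y to meet every w ≤ x of rank at least two
-- in a nontrivial layer, so some hypertorus contains both y and w.  At x = (1, …, 1) take
-- w = {t_k = 1, t_i = t_m^±1}: this gives a k with t_i = 1 on y for all i ≠ k.  At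
-- x = (−1, …, −1) take w = {t_k = t_j = −1}: this puts one of t_k t_j^±1 = 1 into Q.  The join of
-- these two elements of Q is the point (1, …, 1), so Q contains every hypertorus and hence every
-- layer, contradicting that Q is proper.

module Submission where

open import Defs
open import Axiom.ExcludedMiddle using (ExcludedMiddle)
open import Data.Nat.Base using (ℕ; _≤_)
open import Function.Bundles using (_⇔_)
open import Level using (0ℓ; suc)

open import Data.Bool.Base using (Bool; true; false; if_then_else_)
import Data.Bool.Properties as Boolₚ
open import Data.Empty using (⊥; ⊥-elim)
open import Data.Fin.Base as Fin using (Fin; inject₁; fromℕ; toℕ)
import Data.Fin.Properties as Finₚ
open import Data.Integer.Base as ℤ using (ℤ; +_; -[1+_])
import Data.Integer.Properties as ℤₚ
import Data.Integer.DivMod as ℤᵈ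
open import Data.List.Base as List using (List; []; _∷_; length; _++_)
import Data.List.Properties as Listₚ
import Data.List.Membership.Propositional as List∈
open import Data.List.Relation.Unary.Any using (here; there)
open import Data.List.Relation.Unary.All as All using (All; []; _∷_)
open import Data.List.Relation.Unary.Linked as Linked using (Linked; []; [-]; _∷_)
import Data.List.Relation.Unary.Linked.Properties as Linkedₚ
import Data.Nat.Base as ℕ
import Data.Nat.Properties as ℕₚ
open import Data.Product.Base using (Σ; ∃-syntax; Σ-syntax; _×_; _,_; proj₁; proj₂)
open import Data.Rational.Base as ℚ using (ℚ; 0ℚ; 1ℚ; ½)
import Data.Rational.Properties as ℚₚ
open import Data.Rational.Solver using (module +-*-Solver)
import Data.Rational.Unnormalised.Base as ℚᵘ
import Data.Rational.Unnormalised.Properties as ℚᵘₚ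
open import Data.Sum.Base using (_⊎_; inj₁; inj₂; [_,_]′)
open import Data.Unit.Base using (⊤; tt)
open import Function.Base using (_∘_; id)
open import Function.Bundles using (mk⇔; module Equivalence)
open import Level using (Level; Lift; lift; _⊔_)
open import Relation.Binary.Bundles using (Poset)
open import Relation.Binary.Definitions using (Minimum; tri<; tri≈; tri>)
open import Relation.Binary.Lattice.Structures using (IsLattice)
open import Relation.Binary.PropositionalEquality
  using (_≡_; _≢_; refl; sym; trans; cong; cong₂; subst; module ≡-Reasoning)
import Relation.Binary.Properties.Poset as PosetProperties
open import Relation.Nullary using (¬_; Dec; yes; no)
open import Relation.Unary using (Pred; _∈_; _∉_; _⊆_; _∪_; U)


-- Rational estimates

-- The two maximal layers play different roles. All hypertori pass through (1, ..., 1), where the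
-- arrangement is locally of type B; only those of the roots `ε i ± ε j` pass through (-1, ..., -1),
-- where it is locally of type D. For `ℓ = 3` neither point is contradictory by itself, since B₃ and
-- D₃ = A₃ are both supersolvable. The conflict is between the points: one join-closed ideal must
-- serve both, and a hypertorus forced into it at (-1, ..., -1) also passes through (1, ..., 1),
-- where it cuts the coordinate line containing the modular element in a single point. The
-- topological difficulty is that intersections may be disconnected, through equations `t · t = 1`
-- that separate 1 from -1. Two tools deal with it: subtori are connected as coordinate retracts of
-- the torus, and a coordinate with values ±1 is constant on a connected set.

ι : ℤ → ℚ
ι k = k ℚ./ 1

private
  ι-toℚᵘ : ∀ k → ℚ.toℚᵘ (ι k) ℚᵘ.≃ ℚᵘ.mkℚᵘ k 0
  ι-toℚᵘ k = ℚₚ.toℚᵘ-fromℚᵘ (ℚᵘ.mkℚᵘ k 0)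

ι-homo-+ : ∀ k l → ι (k ℤ.+ l) ≡ ι k ℚ.+ ι l
ι-homo-+ k l = ℚₚ.toℚᵘ-injective (begin
  ℚ.toℚᵘ (ι (k ℤ.+ l))                  ≈⟨ ι-toℚᵘ (k ℤ.+ l) ⟩
  ℚᵘ.mkℚᵘ (k ℤ.+ l) 0
    ≈⟨ ℚᵘ.*≡* (cong (ℤ._* + 1) (sym (cong₂ ℤ._+_ (ℤₚ.*-identityʳ k) (ℤₚ.*-identityʳ l)))) ⟩
  ℚᵘ.mkℚᵘ k 0 ℚᵘ.+ ℚᵘ.mkℚᵘ l 0          ≈⟨ ℚᵘₚ.+-cong (ι-toℚᵘ k) (ι-toℚᵘ l) ⟨
  ℚ.toℚᵘ (ι k) ℚᵘ.+ ℚ.toℚᵘ (ι l)        ≈⟨ ℚₚ.toℚᵘ-homo-+ (ι k) (ι l) ⟨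
  ℚ.toℚᵘ (ι k ℚ.+ ι l)                  ∎)
  where open ℚᵘₚ.≃-Reasoning

ι-homo-neg : ∀ k → ι (ℤ.- k) ≡ ℚ.- ι k
ι-homo-neg k = ℚₚ.toℚᵘ-injective (begin
  ℚ.toℚᵘ (ι (ℤ.- k))       ≈⟨ ι-toℚᵘ (ℤ.- k) ⟩
  ℚᵘ.- ℚᵘ.mkℚᵘ k 0         ≈⟨ ℚᵘₚ.-‿cong (ι-toℚᵘ k) ⟨
  ℚᵘ.- ℚ.toℚᵘ (ι k)        ≈⟨ ℚₚ.toℚᵘ-homo‿- (ι k) ⟨
  ℚ.toℚᵘ (ℚ.- ι k)         ∎)
  where open ℚᵘₚ.≃-Reasoning

ι-mono-≤ : ∀ {k l} → k ℤ.≤ l → ι k ℚ.≤ ι l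
ι-mono-≤ {k} {l} k≤l = ℚₚ.toℚᵘ-cancel-≤ (begin
  ℚ.toℚᵘ (ι k)  ≃⟨ ι-toℚᵘ k ⟩
  ℚᵘ.mkℚᵘ k 0   ≤⟨ ℚᵘ.*≤* (ℤₚ.*-monoʳ-≤-nonNeg (+ 1) k≤l) ⟩
  ℚᵘ.mkℚᵘ l 0   ≃⟨ ι-toℚᵘ l ⟨
  ℚ.toℚᵘ (ι l)  ∎)
  where open ℚᵘₚ.≤-Reasoning

halves : ∀ ε → ε ℚ.* ½ ℚ.+ ε ℚ.* ½ ≡ ε
halves ε = trans (sym (ℚₚ.*-distribˡ-+ ε ½ ½)) (ℚₚ.*-identityʳ ε)

half-pos : ∀ {ε} → 0ℚ ℚ.< ε → 0ℚ ℚ.< ε ℚ.* ½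
half-pos {ε} 0<ε =
  subst (ℚ._< ε ℚ.* ½) (ℚₚ.*-zeroˡ ½) (ℚₚ.*-monoˡ-<-pos ½ 0<ε)

gap-pos : ∀ {δ ε} → δ ℚ.< ε → 0ℚ ℚ.< ε ℚ.- δ
gap-pos {δ} {ε} δ<ε =
  subst (ℚ._< ε ℚ.- δ) (ℚₚ.+-inverseʳ δ) (ℚₚ.+-monoˡ-< (ℚ.- δ) δ<ε)

p≤∣p∣ : ∀ p → p ℚ.≤ ℚ.∣ p ∣
p≤∣p∣ p with ℚₚ.≤-total 0ℚ p
... | inj₁ 0≤p = ℚₚ.≤-reflexive (sym (ℚₚ.0≤p⇒∣p∣≡p 0≤p))
... | inj₂ p≤0 = ℚₚ.≤-trans p≤0 (ℚₚ.0≤∣p∣ p)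

-- The bound is attained at `k = 0` and `k = −1`, the extreme cases of the two signs. It becomes the
-- distance between the points 1 and -1 of the circle.
½≤∣½+ι∣ : ∀ k → ½ ℚ.≤ ℚ.∣ 0ℚ ℚ.- (½ ℚ.+ ι k) ∣
½≤∣½+ι∣ k@(+ n) = begin
  ½                               ≡⟨ ℚₚ.+-identityʳ ½ ⟨
  ½ ℚ.+ ι (+ 0)                   ≤⟨ ℚₚ.+-monoʳ-≤ ½ (ι-mono-≤ {+ 0} {k} (ℤ.+≤+ ℕ.z≤n)) ⟩
  ½ ℚ.+ ι k                       ≤⟨ p≤∣p∣ (½ ℚ.+ ι k) ⟩
  ℚ.∣ ½ ℚ.+ ι k ∣                 ≡⟨ ℚₚ.∣-p∣≡∣p∣ (½ ℚ.+ ι k) ⟨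
  ℚ.∣ ℚ.- (½ ℚ.+ ι k) ∣           ≡⟨ cong ℚ.∣_∣ (ℚₚ.+-identityˡ (ℚ.- (½ ℚ.+ ι k))) ⟨
  ℚ.∣ 0ℚ ℚ.- (½ ℚ.+ ι k) ∣        ∎
  where open ℚₚ.≤-Reasoning
½≤∣½+ι∣ k@(-[1+ n ]) = begin
  ½                               ≡⟨⟩
  0ℚ ℚ.- (½ ℚ.+ ι -[1+ 0 ])       ≤⟨ ℚₚ.+-monoʳ-≤ 0ℚ (ℚₚ.neg-antimono-≤
                                       (ℚₚ.+-monoʳ-≤ ½ (ι-mono-≤ {k} { -[1+ 0 ]} (ℤ.-≤- ℕ.z≤n)))) ⟩
  0ℚ ℚ.- (½ ℚ.+ ι k)              ≤⟨ p≤∣p∣ (0ℚ ℚ.- (½ ℚ.+ ι k)) ⟩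
  ℚ.∣ 0ℚ ℚ.- (½ ℚ.+ ι k) ∣        ∎
  where open ℚₚ.≤-Reasoning

-- The circle group

Bounded : ℚ → (ℕ → ℚ) → Set
Bounded δ f = ∃[ N ] ∀ n → N ≤ n → ℚ.∣ f n ∣ ℚ.≤ δ

Bounded-+ : ∀ {δ δ′ f g h} → Bounded δ f → Bounded δ′ g →
            (∀ n → h n ≡ f n ℚ.+ g n) → Bounded (δ ℚ.+ δ′) h
Bounded-+ {δ} {δ′} {f} {g} {h} (N , p) (M , q) h≡ = N ℕ.⊔ M , λ n N≤n → begin
  ℚ.∣ h n ∣                   ≡⟨ cong ℚ.∣_∣ (h≡ n) ⟩
  ℚ.∣ f n ℚ.+ g n ∣           ≤⟨ ℚₚ.∣p+q∣≤∣p∣+∣q∣ (f n) (g n) ⟩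
  ℚ.∣ f n ∣ ℚ.+ ℚ.∣ g n ∣     ≤⟨ ℚₚ.+-mono-≤ (p n (ℕₚ.m⊔n≤o⇒m≤o N M N≤n))
                                             (q n (ℕₚ.m⊔n≤o⇒n≤o N M N≤n)) ⟩
  δ ℚ.+ δ′                    ∎
  where open ℚₚ.≤-Reasoning

Bounded-neg : ∀ {δ f h} → Bounded δ f → (∀ n → h n ≡ ℚ.- f n) → Bounded δ h
Bounded-neg {δ} {f} (N , p) h≡ = N , λ n N≤n →
  subst (ℚ._≤ δ) (sym (trans (cong ℚ.∣_∣ (h≡ n)) (ℚₚ.∣-p∣≡∣p∣ (f n)))) (p n N≤n)

Within-+ : ∀ {ε ε′} x y x′ y′ u v → Within ε x y → Within ε′ x′ y′ →
           (∀ n → seq u n ℚ.- seq v n ≡ (seq x n ℚ.- seq y n) ℚ.+ (seq x′ n ℚ.- seq y′ n)) →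
           Within (ε ℚ.+ ε′) u v
Within-+ x y x′ y′ u v (δ , δ<ε , b) (δ′ , δ′<ε′ , b′) eq =
  δ ℚ.+ δ′ , ℚₚ.+-mono-< δ<ε δ′<ε′ , Bounded-+ b b′ eq

Within-neg : ∀ {ε} x y u v → Within ε x y →
             (∀ n → seq u n ℚ.- seq v n ≡ ℚ.- (seq x n ℚ.- seq y n)) → Within ε u v
Within-neg x y u v (δ , δ<ε , b) eq = δ , δ<ε , Bounded-neg b eq

private
  shift-+ : ∀ x y x′ y′ u v k k′ → u ℚ.- v ≡ (x ℚ.- y) ℚ.+ (x′ ℚ.- y′) →
            u ℚ.- (v ℚ.+ ι (k ℤ.+ k′)) ≡
            (x ℚ.- (y ℚ.+ ι k)) ℚ.+ (x′ ℚ.- (y′ ℚ.+ ι k′))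
  shift-+ x y x′ y′ u v k k′ eq = begin
    u ℚ.- (v ℚ.+ ι (k ℤ.+ k′))
      ≡⟨ cong (λ z → u ℚ.- (v ℚ.+ z)) (ι-homo-+ k k′) ⟩
    u ℚ.- (v ℚ.+ (ι k ℚ.+ ι k′))
      ≡⟨ solve 4 (λ u v k k′ → u :- (v :+ (k :+ k′)) := (u :- v) :- (k :+ k′)) refl u v (ι k) (ι k′) ⟩
    (u ℚ.- v) ℚ.- (ι k ℚ.+ ι k′)
      ≡⟨ cong (ℚ._- (ι k ℚ.+ ι k′)) eq ⟩
    ((x ℚ.- y) ℚ.+ (x′ ℚ.- y′)) ℚ.- (ι k ℚ.+ ι k′)
      ≡⟨ solve 6 (λ x y x′ y′ k k′ → ((x :- y) :+ (x′ :- y′)) :- (k :+ k′) :=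
           (x :- (y :+ k)) :+ (x′ :- (y′ :+ k′))) refl x y x′ y′ (ι k) (ι k′) ⟩
    (x ℚ.- (y ℚ.+ ι k)) ℚ.+ (x′ ℚ.- (y′ ℚ.+ ι k′)) ∎
    where
    open +-*-Solver
    open ≡-Reasoning

  shift-neg : ∀ x y u v k → u ℚ.- v ≡ ℚ.- (x ℚ.- y) →
              u ℚ.- (v ℚ.+ ι (ℤ.- k)) ≡ ℚ.- (x ℚ.- (y ℚ.+ ι k))
  shift-neg x y u v k eq = begin
    u ℚ.- (v ℚ.+ ι (ℤ.- k))
      ≡⟨ cong (λ z → u ℚ.- (v ℚ.+ z)) (ι-homo-neg k) ⟩
    u ℚ.- (v ℚ.+ ℚ.- ι k)
      ≡⟨ solve 3 (λ u v k → u :- (v :+ (:- k)) := (u :- v) :+ k) refl u v (ι k) ⟩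
    (u ℚ.- v) ℚ.+ ι k
      ≡⟨ cong (ℚ._+ ι k) eq ⟩
    ℚ.- (x ℚ.- y) ℚ.+ ι k
      ≡⟨ solve 3 (λ x y k → (:- (x :- y)) :+ k := :- (x :- (y :+ k))) refl x y (ι k) ⟩
    ℚ.- (x ℚ.- (y ℚ.+ ι k)) ∎
    where
    open +-*-Solver
    open ≡-Reasoning

-- Consequences of congruences are drawn by exhibiting the difference of the
-- two sides as a combination of differences already known to be integral.
≈₁-+ : ∀ {t s t′ s′ u v} → t ≈₁ s → t′ ≈₁ s′ →
       (∀ n → seq u n ℚ.- seq v n ≡ (seq t n ℚ.- seq s n) ℚ.+ (seq t′ n ℚ.- seq s′ n)) →
       u ≈₁ v
≈₁-+ {t} {s} {t′} {s′} {u} {v} (k , p) (k′ , p′) eq = k ℤ.+ k′ , λ ε 0<ε →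
  subst (λ ε → Within ε u (v +ᵣ fromℤ (k ℤ.+ k′))) (halves ε)
    (Within-+ t (s +ᵣ fromℤ k) t′ (s′ +ᵣ fromℤ k′) u (v +ᵣ fromℤ (k ℤ.+ k′))
      (p (ε ℚ.* ½) (half-pos 0<ε)) (p′ (ε ℚ.* ½) (half-pos 0<ε))
      (λ n → shift-+ (seq t n) (seq s n) (seq t′ n) (seq s′ n)
                   (seq u n) (seq v n) k k′ (eq n)))

≈₁-neg : ∀ {t s u v} → t ≈₁ s →
         (∀ n → seq u n ℚ.- seq v n ≡ ℚ.- (seq t n ℚ.- seq s n)) → u ≈₁ v
≈₁-neg {t} {s} {u} {v} (k , p) eq = ℤ.- k , λ ε 0<ε →
  Within-neg t (s +ᵣ fromℤ k) u (v +ᵣ fromℤ (ℤ.- k)) (p ε 0<ε) (λ n → shift-neg (seq t n) (seq s n) (seq u n) (seq v n) k (eq n))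

≈₁-by-ι : ∀ {u v} k → (∀ n → seq u n ℚ.- seq v n ≡ ι k) → u ≈₁ v
≈₁-by-ι {u} {v} k eq = k , λ ε 0<ε → 0ℚ , 0<ε , 0 , λ n _ →
  ℚₚ.≤-reflexive (cong ℚ.∣_∣ (lem n (eq n)))
  where
  open +-*-Solver
  lem : ∀ n → seq u n ℚ.- seq v n ≡ ι k → seq u n ℚ.- (seq v n ℚ.+ ι k) ≡ 0ℚ
  lem n e = trans
    (solve 3 (λ u v k → u :- (v :+ k) := (u :- v) :- k) refl (seq u n) (seq v n) (ι k))
    (trans (cong (ℚ._- ι k) e) (ℚₚ.+-inverseʳ (ι k)))

≈₁-by-≡ : ∀ {u v} → (∀ n → seq u n ≡ seq v n) → u ≈₁ v
≈₁-by-≡ {u} {v} eq = ≈₁-by-ι {u} {v} (+ 0) λ n →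
  trans (cong (ℚ._- seq v n) (eq n)) (ℚₚ.+-inverseʳ (seq v n))

≈₁-refl : ∀ {t} → t ≈₁ t
≈₁-refl {t} = ≈₁-by-≡ {t} {t} (λ _ → refl)

≈₁-sym : ∀ {t s} → t ≈₁ s → s ≈₁ t
≈₁-sym {t} {s} p = ≈₁-neg {t} {s} {s} {t} p λ n →
  solve 2 (λ t s → s :- t := :- (t :- s)) refl (seq t n) (seq s n)
  where open +-*-Solver

≈₁-trans : ∀ {t s u} → t ≈₁ s → s ≈₁ u → t ≈₁ u
≈₁-trans {t} {s} {u} p q = ≈₁-+ {t} {s} {s} {u} {t} {u} p q λ n →
  solve 3 (λ t s u → t :- u := (t :- s) :+ (s :- u)) refl (seq t n) (seq s n) (seq u n)
  where open +-*-Solver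

Near-+ : ∀ {ε ε′ t s t′ s′ u v} → Near ε t s → Near ε′ t′ s′ →
         (∀ n → seq u n ℚ.- seq v n ≡ (seq t n ℚ.- seq s n) ℚ.+ (seq t′ n ℚ.- seq s′ n)) →
         Near (ε ℚ.+ ε′) u v
Near-+ {_} {_} {t} {s} {t′} {s′} {u} {v} (k , p) (k′ , p′) eq = k ℤ.+ k′ ,
  Within-+ t (s +ᵣ fromℤ k) t′ (s′ +ᵣ fromℤ k′) u (v +ᵣ fromℤ (k ℤ.+ k′)) p p′
    (λ n → shift-+ (seq t n) (seq s n) (seq t′ n) (seq s′ n)
                   (seq u n) (seq v n) k k′ (eq n))

Near-neg : ∀ {ε t s u v} → Near ε t s →
           (∀ n → seq u n ℚ.- seq v n ≡ ℚ.- (seq t n ℚ.- seq s n)) → Near ε u v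
Near-neg {_} {t} {s} {u} {v} (k , p) eq = ℤ.- k ,
  Within-neg t (s +ᵣ fromℤ k) u (v +ᵣ fromℤ (ℤ.- k)) p (λ n → shift-neg (seq t n) (seq s n) (seq u n) (seq v n) k (eq n))

≈₁⇒Near : ∀ {ε t s} → 0ℚ ℚ.< ε → t ≈₁ s → Near ε t s
≈₁⇒Near 0<ε (k , p) = k , p _ 0<ε

Near-refl : ∀ {ε t} → 0ℚ ℚ.< ε → Near ε t t
Near-refl {ε} {t} 0<ε = ≈₁⇒Near {ε} {t} {t} 0<ε (≈₁-refl {t})

Near-sym : ∀ {ε t s} → Near ε t s → Near ε s t
Near-sym {ε} {t} {s} p = Near-neg {ε} {t} {s} {s} {t} p λ n →
  solve 2 (λ t s → s :- t := :- (t :- s)) refl (seq t n) (seq s n)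
  where open +-*-Solver

Near-trans : ∀ {ε ε′ t s u} → Near ε t s → Near ε′ s u → Near (ε ℚ.+ ε′) t u
Near-trans {_} {_} {t} {s} {u} p q = Near-+ {t = t} {s} {s} {u} {t} {u} p q λ n →
  solve 3 (λ t s u → t :- u := (t :- s) :+ (s :- u)) refl (seq t n) (seq s n) (seq u n)
  where open +-*-Solver

-- `Within` records a rational bound `δ` strictly below `ε`. Half of this slack goes into keeping
-- the first estimate strict (`δ < δ′`), the rest is the radius `ε − δ′`.
Near-open : ∀ {ε t s} → Near ε t s →
            ∃[ η ] 0ℚ ℚ.< η × (∀ u → Near η s u → Near ε t u)
Near-open {ε} {t} {s} (k , δ , δ<ε , b) = ε ℚ.- δ′ , gap-pos δ′<ε , λ u q →
  subst (λ z → Near z t u) (solve 2 (λ ε δ → δ :+ (ε :- δ) := ε) refl ε δ′)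
    (Near-trans {δ′} {ε ℚ.- δ′} {t} {s} {u} (k , δ , δ<δ′ , b) q)
  where
  open +-*-Solver
  mid = ℚₚ.<-dense δ<ε
  δ′ = proj₁ mid
  δ<δ′ = proj₁ (proj₂ mid)
  δ′<ε = proj₂ (proj₂ mid)

-- The point −1 of the circle.
½₁ : 𝕊¹
½₁ = fromℚ ½

1₁≁½₁ : ¬ Near ½ 1₁ ½₁
1₁≁½₁ (k , δ , δ<½ , N , b) =
  ℚₚ.<-irrefl refl (ℚₚ.≤-<-trans (ℚₚ.≤-trans (½≤∣½+ι∣ k) (b N ℕₚ.≤-refl)) δ<½)

½₁≉1₁ : ¬ (½₁ ≈₁ 1₁)
½₁≉1₁ p = 1₁≁½₁ (≈₁⇒Near {½} {1₁} {½₁} (ℚₚ.positive⁻¹ ½) (≈₁-sym {½₁} {1₁} p))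

private
  Within-half : ∀ {ε} x y u v → Within (ε ℚ.+ ε) x y →
                (∀ n → seq x n ℚ.- seq y n ≡ (seq u n ℚ.- seq v n) ℚ.+ (seq u n ℚ.- seq v n)) →
                Within ε u v
  Within-half {ε} x y u v (δ , δ<2ε , N , b) eq = δ ℚ.* ½ ,
    subst (δ ℚ.* ½ ℚ.<_) (trans (ℚₚ.*-distribʳ-+ ½ ε ε) (halves ε)) (ℚₚ.*-monoˡ-<-pos ½ δ<2ε) ,
    N , λ n N≤n → let d = seq u n ℚ.- seq v n in begin
      ℚ.∣ d ∣
        ≡⟨ cong ℚ.∣_∣ (trans (sym (halves d)) (sym (ℚₚ.*-distribʳ-+ ½ d d))) ⟩
      ℚ.∣ (d ℚ.+ d) ℚ.* ½ ∣                       ≡⟨ cong (λ z → ℚ.∣ z ℚ.* ½ ∣) (sym (eq n)) ⟩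
      ℚ.∣ (seq x n ℚ.- seq y n) ℚ.* ½ ∣           ≡⟨ ℚₚ.∣p*q∣≡∣p∣*∣q∣ (seq x n ℚ.- seq y n) ½ ⟩
      ℚ.∣ seq x n ℚ.- seq y n ∣ ℚ.* ½             ≤⟨ ℚₚ.*-monoʳ-≤-nonNeg ½ (b n N≤n) ⟩
      δ ℚ.* ½                                     ∎
    where open ℚₚ.≤-Reasoning

  parity : ∀ k → ∃[ m ] (k ≡ m ℤ.+ m ⊎ k ≡ + 1 ℤ.+ (m ℤ.+ m))
  parity k = k ℤᵈ./ (+ 2) , go (k ℤᵈ.% (+ 2)) (ℤᵈ.n%d<d k (+ 2)) (ℤᵈ.a≡a%n+[a/n]*n k (+ 2))
    where
    m = k ℤᵈ./ (+ 2)
    dbl : m ℤ.* + 2 ≡ m ℤ.+ m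
    dbl = trans (ℤₚ.*-distribˡ-+ m (+ 1) (+ 1)) (cong₂ ℤ._+_ (ℤₚ.*-identityʳ m) (ℤₚ.*-identityʳ m))
    go : ∀ r → r ℕ.< 2 → k ≡ + r ℤ.+ m ℤ.* + 2 → k ≡ m ℤ.+ m ⊎ k ≡ + 1 ℤ.+ (m ℤ.+ m)
    go 0 _ e = inj₁ (trans e (trans (ℤₚ.+-identityˡ _) dbl))
    go 1 _ e = inj₂ (trans e (cong (λ z → + 1 ℤ.+ z) dbl))
    go (ℕ.suc (ℕ.suc _)) (ℕ.s≤s (ℕ.s≤s ())) _

-- Additively `2t` is an integer `k`; halving the Cauchy estimate leaves 0 or ½ modulo ℤ according
-- to the parity of `k`.
t²≈1⇒t≈1∨½ : ∀ {t} → t · t ≈₁ 1₁ → t ≈₁ 1₁ ⊎ t ≈₁ ½₁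
t²≈1⇒t≈1∨½ {t} (k , p) with parity k
... | m , inj₁ refl = inj₁ (m , λ ε 0<ε →
  Within-half (t · t) (1₁ +ᵣ fromℤ k) t (1₁ +ᵣ fromℤ m) (p (ε ℚ.+ ε) (ℚₚ.+-mono-< 0<ε 0<ε)) λ n →
    trans (cong (λ z → seq t n ℚ.+ seq t n ℚ.- (0ℚ ℚ.+ z)) (ι-homo-+ m m))
      (solve 2 (λ t m → (t :+ t) :- (con 0ℚ :+ (m :+ m)) :=
        (t :- (con 0ℚ :+ m)) :+ (t :- (con 0ℚ :+ m))) refl (seq t n) (ι m)))
  where open +-*-Solver
... | m , inj₂ refl = inj₂ (m , λ ε 0<ε →
  Within-half (t · t) (1₁ +ᵣ fromℤ k) t (½₁ +ᵣ fromℤ m) (p (ε ℚ.+ ε) (ℚₚ.+-mono-< 0<ε 0<ε)) λ n →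
    trans (cong (λ z → seq t n ℚ.+ seq t n ℚ.- (0ℚ ℚ.+ z))
             (trans (ι-homo-+ (+ 1) (m ℤ.+ m)) (cong (1ℚ ℚ.+_) (ι-homo-+ m m))))
      (solve 2 (λ t m → (t :+ t) :- (con 0ℚ :+ (con 1ℚ :+ (m :+ m))) :=
        (t :- (con ½ :+ m)) :+ (t :- (con ½ :+ m))) refl (seq t n) (ι m)))
  where open +-*-Solver

-- Dyadic approximation

dyad : ℕ → ℚ
dyad ℕ.zero    = 1ℚ
dyad (ℕ.suc n) = dyad n ℚ.* ½

0<dyad : ∀ n → 0ℚ ℚ.< dyad n
0<dyad ℕ.zero    = ℚₚ.positive⁻¹ 1ℚ
0<dyad (ℕ.suc n) = half-pos (0<dyad n)

dyad-halves : ∀ n → dyad (ℕ.suc n) ℚ.+ dyad (ℕ.suc n) ≡ dyad n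
dyad-halves n = halves (dyad n)

dyad-suc-≤ : ∀ n → dyad (ℕ.suc n) ℚ.≤ dyad n
dyad-suc-≤ n = begin
  dyad (ℕ.suc n)                        ≡⟨ ℚₚ.+-identityʳ _ ⟨
  dyad (ℕ.suc n) ℚ.+ 0ℚ                 ≤⟨ ℚₚ.+-monoʳ-≤ (dyad (ℕ.suc n)) (ℚₚ.<⇒≤ (0<dyad (ℕ.suc n))) ⟩
  dyad (ℕ.suc n) ℚ.+ dyad (ℕ.suc n)     ≡⟨ dyad-halves n ⟩
  dyad n                                ∎
  where open ℚₚ.≤-Reasoning

dyad-antitone : ∀ {m n} → m ≤ n → dyad n ℚ.≤ dyad m
dyad-antitone m≤n = go (ℕₚ.≤⇒≤′ m≤n)
  where
  go : ∀ {m n} → m ℕ.≤′ n → dyad n ℚ.≤ dyad m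
  go (ℕ.≤′-reflexive refl) = ℚₚ.≤-refl
  go {n = ℕ.suc n} (ℕ.≤′-step p) = ℚₚ.≤-trans (dyad-suc-≤ n) (go p)

-- A form of `n ≤ 2ⁿ`; with the Archimedean property it makes dyadic widths arbitrarily small.
dyad*n≤1 : ∀ n → dyad n ℚ.* ι (+ n) ℚ.≤ 1ℚ
dyad*n≤1 ℕ.zero    = ℚₚ.nonNegative⁻¹ 1ℚ
dyad*n≤1 (ℕ.suc n) = begin
  dyad n ℚ.* ½ ℚ.* ι (+ ℕ.suc n)
    ≡⟨ cong (dyad n ℚ.* ½ ℚ.*_) (ι-homo-+ (+ 1) (+ n)) ⟩
  dyad n ℚ.* ½ ℚ.* (1ℚ ℚ.+ ι (+ n))
    ≡⟨ solve 2 (λ d n → d :* con ½ :* (con 1ℚ :+ n) := d :* con ½ :+ (d :* n) :* con ½) refl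
         (dyad n) (ι (+ n)) ⟩
  dyad n ℚ.* ½ ℚ.+ dyad n ℚ.* ι (+ n) ℚ.* ½
    ≤⟨ ℚₚ.+-mono-≤ (ℚₚ.*-monoʳ-≤-nonNeg ½ (dyad-antitone {0} {n} ℕ.z≤n))
                   (ℚₚ.*-monoʳ-≤-nonNeg ½ (dyad*n≤1 n)) ⟩
  1ℚ ∎
  where
  open ℚₚ.≤-Reasoning
  open +-*-Solver

q<ι : ∀ q → ∃[ n ] q ℚ.< ι (+ n)
q<ι q@record{} = ℕ.suc ℤ.∣ ℚ.↥ q ∣ , ℚₚ.toℚᵘ-cancel-< (ℚᵘₚ.<-respʳ-≃
  (ℚᵘₚ.≃-sym (ℚₚ.toℚᵘ-fromℚᵘ (ℚᵘ.mkℚᵘ (+ ℕ.suc ℤ.∣ ℚ.↥ q ∣) 0))) (ℚᵘ.*<* (begin-strict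
  ℚ.↥ q ℤ.* + 1              ≡⟨ ℤₚ.*-identityʳ (ℚ.↥ q) ⟩
  ℚ.↥ q                      ≤⟨ i≤∣i∣ (ℚ.↥ q) ⟩
  + ℤ.∣ ℚ.↥ q ∣              <⟨ ℤ.+<+ (ℕₚ.n<1+n _) ⟩
  + ℕ.suc ℤ.∣ ℚ.↥ q ∣        ≤⟨ ℤ.+≤+ (ℕₚ.m≤m*n (ℕ.suc ℤ.∣ ℚ.↥ q ∣) (ℚ.↧ₙ q)) ⟩
  + (ℕ.suc ℤ.∣ ℚ.↥ q ∣ ℕ.* ℚ.↧ₙ q)  ≡⟨ ℤₚ.pos-* (ℕ.suc ℤ.∣ ℚ.↥ q ∣) (ℚ.↧ₙ q) ⟩
  + ℕ.suc ℤ.∣ ℚ.↥ q ∣ ℤ.* ℚ.↧ q ∎)))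
  where
  open ℤₚ.≤-Reasoning
  i≤∣i∣ : ∀ i → i ℤ.≤ + ℤ.∣ i ∣
  i≤∣i∣ (+ _)    = ℤₚ.≤-refl
  i≤∣i∣ -[1+ _ ] = ℤ.-≤+

dyad*c<ε : ∀ c {ε} → 0ℚ ℚ.< ε → ∃[ n ] dyad n ℚ.* c ℚ.< ε
dyad*c<ε c {ε} 0<ε = n , (begin-strict
  dyad n ℚ.* c                       <⟨ ℚₚ.*-monoʳ-<-pos (dyad n) {{ℚ.positive (0<dyad n)}} c<nε ⟩
  dyad n ℚ.* (ι (+ n) ℚ.* ε)         ≡⟨ ℚₚ.*-assoc (dyad n) (ι (+ n)) ε ⟨
  dyad n ℚ.* ι (+ n) ℚ.* ε           ≤⟨ ℚₚ.*-monoʳ-≤-nonNeg ε {{ℚ.nonNegative (ℚₚ.<⇒≤ 0<ε)}} (dyad*n≤1 n) ⟩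
  1ℚ ℚ.* ε                           ≡⟨ ℚₚ.*-identityˡ ε ⟩
  ε                                  ∎)
  where
  open ℚₚ.≤-Reasoning
  instance
    ε-pos : ℚ.Positive ε
    ε-pos = ℚ.positive 0<ε
    ε≢0 : ℚ.NonZero ε
    ε≢0 = ℚₚ.pos⇒nonZero ε
  -- Any `n > c / ε` works, as then `2⁻ⁿ · c < 2⁻ⁿ · n · ε ≤ ε`.
  quotient = q<ι (c ℚ.* ℚ.1/ ε)
  n = proj₁ quotient
  c<nε : c ℚ.< ι (+ n) ℚ.* ε
  c<nε = subst (ℚ._< ι (+ n) ℚ.* ε)
    (trans (ℚₚ.*-assoc c (ℚ.1/ ε) ε)
      (trans (cong (c ℚ.*_) (ℚₚ.*-inverseˡ ε)) (ℚₚ.*-identityʳ c)))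
    (ℚₚ.*-monoˡ-<-pos ε (proj₂ quotient))

dyadic-cauchy : ∀ x c → (∀ n m → n ≤ m → ℚ.∣ x m ℚ.- x n ∣ ℚ.≤ dyad n ℚ.* c) → IsCauchy x
dyadic-cauchy x c close ε 0<ε = N , λ m n N≤m N≤n → begin-strict
  ℚ.∣ x m ℚ.- x n ∣
    ≡⟨ cong ℚ.∣_∣ (solve 3 (λ a b c → a :- b := (a :- c) :+ (:- (b :- c))) refl (x m) (x n) (x N)) ⟩
  ℚ.∣ (x m ℚ.- x N) ℚ.+ ℚ.- (x n ℚ.- x N) ∣
    ≤⟨ ℚₚ.∣p+q∣≤∣p∣+∣q∣ (x m ℚ.- x N) (ℚ.- (x n ℚ.- x N)) ⟩
  ℚ.∣ x m ℚ.- x N ∣ ℚ.+ ℚ.∣ ℚ.- (x n ℚ.- x N) ∣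
    ≡⟨ cong (ℚ.∣ x m ℚ.- x N ∣ ℚ.+_) (ℚₚ.∣-p∣≡∣p∣ (x n ℚ.- x N)) ⟩
  ℚ.∣ x m ℚ.- x N ∣ ℚ.+ ℚ.∣ x n ℚ.- x N ∣
    <⟨ ℚₚ.+-mono-< (ℚₚ.≤-<-trans (close N m N≤m) small) (ℚₚ.≤-<-trans (close N n N≤n) small) ⟩
  ε ℚ.* ½ ℚ.+ ε ℚ.* ½
    ≡⟨ halves ε ⟩
  ε ∎
  where
  open ℚₚ.≤-Reasoning
  open +-*-Solver
  N = proj₁ (dyad*c<ε c (half-pos 0<ε))
  small = proj₂ (dyad*c<ε c (half-pos 0<ε))

∣b-a∣≤w : ∀ {a b w} → a ℚ.≤ b → b ℚ.≤ a ℚ.+ w → ℚ.∣ b ℚ.- a ∣ ℚ.≤ w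
∣b-a∣≤w {a} {b} {w} a≤b b≤a+w = begin
  ℚ.∣ b ℚ.- a ∣      ≡⟨ ℚₚ.0≤p⇒∣p∣≡p (subst (ℚ._≤ b ℚ.- a) (ℚₚ.+-inverseʳ a) (ℚₚ.+-monoˡ-≤ (ℚ.- a) a≤b)) ⟩
  b ℚ.- a            ≤⟨ ℚₚ.+-monoˡ-≤ (ℚ.- a) b≤a+w ⟩
  a ℚ.+ w ℚ.- a      ≡⟨ solve 2 (λ a w → a :+ w :- a := w) refl a w ⟩
  w                  ∎
  where
  open ℚₚ.≤-Reasoning
  open +-*-Solver

∣b-a-w∣≤w : ∀ {a b w} → a ℚ.≤ b → b ℚ.≤ a ℚ.+ w → ℚ.∣ b ℚ.- (a ℚ.+ w) ∣ ℚ.≤ w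
∣b-a-w∣≤w {a} {b} {w} a≤b b≤a+w =
  subst (ℚ._≤ w) (trans (sym (ℚₚ.∣-p∣≡∣p∣ ((a ℚ.+ w) ℚ.- b)))
      (cong ℚ.∣_∣ (solve 3 (λ a b w → :- ((a :+ w) :- b) := b :- (a :+ w)) refl a b w)))
    (∣b-a∣≤w {b} {a ℚ.+ w} b≤a+w (ℚₚ.+-monoˡ-≤ w a≤b))
  where open +-*-Solver

module Bisection (A B : ℚ → Set) (cover : ∀ q → A q ⊎ B q) (a : A 0ℚ) (b : B 1ℚ) where

  -- The invariant is that the left end lies in `A` and the right end in `B`; whichever set `cover`
  -- assigns to the midpoint tells which half keeps it. Both ends converge to one point.
  bisect : ∀ n → Σ[ l ∈ ℚ ] A l × B (l ℚ.+ dyad n)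
  bisect ℕ.zero = 0ℚ , a , b
  bisect (ℕ.suc n) with bisect n
  ... | l , al , bl with cover (l ℚ.+ dyad (ℕ.suc n))
  ...   | inj₁ am = l ℚ.+ dyad (ℕ.suc n) , am ,
          subst B (sym (trans (ℚₚ.+-assoc l _ _) (cong (l ℚ.+_) (dyad-halves n)))) bl
  ...   | inj₂ bm = l , al , bm

  lo : ℕ → ℚ
  lo n = proj₁ (bisect n)

  A-lo : ∀ n → A (lo n)
  A-lo n = proj₁ (proj₂ (bisect n))

  B-hi : ∀ n → B (lo n ℚ.+ dyad n)
  B-hi n = proj₂ (proj₂ (bisect n))

  nested-suc : ∀ n → lo n ℚ.≤ lo (ℕ.suc n) ×
               lo (ℕ.suc n) ℚ.+ dyad (ℕ.suc n) ℚ.≤ lo n ℚ.+ dyad n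
  nested-suc n with bisect n
  ... | l , al , bl with cover (l ℚ.+ dyad (ℕ.suc n))
  ...   | inj₁ am = subst (ℚ._≤ l ℚ.+ dyad (ℕ.suc n)) (ℚₚ.+-identityʳ l)
                      (ℚₚ.+-monoʳ-≤ l (ℚₚ.<⇒≤ (0<dyad (ℕ.suc n)))) ,
                    ℚₚ.≤-reflexive (trans (ℚₚ.+-assoc l _ _) (cong (l ℚ.+_) (dyad-halves n)))
  ...   | inj₂ bm = ℚₚ.≤-refl , ℚₚ.+-monoʳ-≤ l (dyad-suc-≤ n)

  nested : ∀ {n m} → n ℕ.≤′ m → lo n ℚ.≤ lo m × lo m ℚ.+ dyad m ℚ.≤ lo n ℚ.+ dyad n
  nested (ℕ.≤′-reflexive refl) = ℚₚ.≤-refl , ℚₚ.≤-refl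
  nested {m = ℕ.suc m} (ℕ.≤′-step p) =
    ℚₚ.≤-trans (proj₁ (nested p)) (proj₁ (nested-suc m)) ,
    ℚₚ.≤-trans (proj₂ (nested-suc m)) (proj₂ (nested p))

  lo≤lo : ∀ {n m} → n ≤ m → lo n ℚ.≤ lo m
  lo≤lo n≤m = proj₁ (nested (ℕₚ.≤⇒≤′ n≤m))

  lo≤hi : ∀ {n m} → n ≤ m → lo m ℚ.≤ lo n ℚ.+ dyad n
  lo≤hi {n} {m} n≤m = ℚₚ.≤-trans
    (subst (ℚ._≤ lo m ℚ.+ dyad m) (ℚₚ.+-identityʳ (lo m)) (ℚₚ.+-monoʳ-≤ (lo m) (ℚₚ.<⇒≤ (0<dyad m))))
    (proj₂ (nested (ℕₚ.≤⇒≤′ n≤m)))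

-- Connected subsets of the torus

module _ {ℓ : ℕ} where

  infix 4 _≋_
  _≋_ : Torus ℓ → Torus ℓ → Set
  t ≋ s = ∀ i → t i ≈₁ s i

  ≋-refl : ∀ {t} → t ≋ t
  ≋-refl {t} i = ≈₁-refl {t i}

  ≋-sym : ∀ {t s} → t ≋ s → s ≋ t
  ≋-sym {t} {s} p i = ≈₁-sym {t i} {s i} (p i)

  ≋-trans : ∀ {t s u} → t ≋ s → s ≋ u → t ≋ u
  ≋-trans {t} {s} {u} p q i = ≈₁-trans {t i} {s i} {u i} (p i) (q i)

  Open-resp-≋ : ∀ {A} → Open A → ∀ {t s} → t ≋ s → t ∈ A → s ∈ A
  Open-resp-≋ open-A {t} {s} t≋s t∈A with open-A t t∈A
  ... | ε , 0<ε , ball = ball (λ i → ≈₁⇒Near {ε} {t i} {s i} 0<ε (t≋s i))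

fin-bound : ∀ {n} (f : Fin n → ℕ) → ∃[ N ] ∀ i → f i ≤ N
fin-bound {ℕ.zero}  f = 0 , λ ()
fin-bound {ℕ.suc n} f with fin-bound (f ∘ Fin.suc)
... | N , p = f Fin.zero ℕ.⊔ N , λ where
  Fin.zero    → ℕₚ.m≤m⊔n (f Fin.zero) N
  (Fin.suc i) → ℕₚ.≤-trans (p i) (ℕₚ.m≤n⊔m (f Fin.zero) N)

Near-by-bound : ∀ {ε δ t s} → δ ℚ.< ε →
                (∃[ N ] ∀ n → N ≤ n → ℚ.∣ seq t n ℚ.- seq s n ∣ ℚ.≤ δ) → Near ε t s
Near-by-bound {ε} {δ} {t} {s} δ<ε (N , b) = + 0 , δ , δ<ε , N , λ n N≤n →
  subst (λ z → ℚ.∣ seq t n ℚ.- z ∣ ℚ.≤ δ) (sym (ℚₚ.+-identityʳ (seq s n))) (b n N≤n)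

rationalPoint : ∀ {ℓ} → (Fin ℓ → ℚ) → Torus ℓ
rationalPoint a i = fromℚ (a i)

-- A late term of each coordinate's Cauchy sequence is a rational approximation. Between rational
-- points the segment has rational coordinates at rational parameters, so no product of real numbers
-- arises.
rational-dense : ∀ {ℓ} {A : Pred (Torus ℓ) 0ℓ} → Open A → ∀ t → t ∈ A →
                 ∃[ a ] rationalPoint a ∈ A
rational-dense {A = A} open-A t t∈A with open-A t t∈A
... | ε , 0<ε , ball = a , ball near
  where
  N = λ i → proj₁ (cauchy (t i) (ε ℚ.* ½) (half-pos 0<ε))
  a = λ i → seq (t i) (N i)
  near : Ball t ε (rationalPoint a)
  near i = Near-by-bound {ε} {ε ℚ.* ½} {t i} {fromℚ (a i)} half< (N i , λ n N≤n →
    ℚₚ.<⇒≤ (proj₂ (cauchy (t i) (ε ℚ.* ½) (half-pos 0<ε)) n (N i) N≤n ℕₚ.≤-refl))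
    where
    half< : ε ℚ.* ½ ℚ.< ε
    half< = subst (ε ℚ.* ½ ℚ.<_) (halves ε)
      (subst (ℚ._< ε ℚ.* ½ ℚ.+ ε ℚ.* ½) (ℚₚ.+-identityʳ (ε ℚ.* ½))
        (ℚₚ.+-monoʳ-< (ε ℚ.* ½) (half-pos 0<ε)))

-- Bisection along a straight path between rational points.
torus-connected : ∀ {ℓ} → Connected {ℓ} U
torus-connected {ℓ} A B open-A open-B cover (t , _ , t∈A) (s , _ , s∈B) =
  conclude (cover {limit} tt)
  where
  a = proj₁ (rational-dense open-A t t∈A)
  b = proj₁ (rational-dense open-B s s∈B)
  d : Fin ℓ → ℚ
  d i = b i ℚ.- a i
  path : ℚ → Torus ℓ
  path q = rationalPoint (λ i → a i ℚ.+ q ℚ.* d i)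

  path-0 : path 0ℚ ∈ A
  path-0 = Open-resp-≋ open-A (λ i → ≈₁-by-≡ {fromℚ (a i)} {path 0ℚ i} λ _ →
    solve 2 (λ a d → a := a :+ con 0ℚ :* d) refl (a i) (d i)) (proj₂ (rational-dense open-A t t∈A))
    where open +-*-Solver
  path-1 : path 1ℚ ∈ B
  path-1 = Open-resp-≋ open-B (λ i → ≈₁-by-≡ {fromℚ (b i)} {path 1ℚ i} λ _ →
    solve 2 (λ a b → b := a :+ con 1ℚ :* (b :- a)) refl (a i) (b i)) (proj₂ (rational-dense open-B s s∈B))
    where open +-*-Solver

  open Bisection (A ∘ path) (B ∘ path) (λ q → cover {path q} tt) path-0 path-1

  close : ∀ i q q′ n → ℚ.∣ q ℚ.- q′ ∣ ℚ.≤ dyad n →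
          ℚ.∣ (a i ℚ.+ q ℚ.* d i) ℚ.- (a i ℚ.+ q′ ℚ.* d i) ∣ ℚ.≤ dyad n ℚ.* ℚ.∣ d i ∣
  close i q q′ n le = begin
    ℚ.∣ (a i ℚ.+ q ℚ.* d i) ℚ.- (a i ℚ.+ q′ ℚ.* d i) ∣
      ≡⟨ cong ℚ.∣_∣ (solve 4 (λ a d q q′ → (a :+ q :* d) :- (a :+ q′ :* d) := (q :- q′) :* d) refl
           (a i) (d i) q q′) ⟩
    ℚ.∣ (q ℚ.- q′) ℚ.* d i ∣           ≡⟨ ℚₚ.∣p*q∣≡∣p∣*∣q∣ (q ℚ.- q′) (d i) ⟩
    ℚ.∣ q ℚ.- q′ ∣ ℚ.* ℚ.∣ d i ∣       ≤⟨ ℚₚ.*-monoʳ-≤-nonNeg ℚ.∣ d i ∣ {{ℚₚ.∣-∣-nonNeg (d i)}} le ⟩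
    dyad n ℚ.* ℚ.∣ d i ∣               ∎
    where
    open ℚₚ.≤-Reasoning
    open +-*-Solver

  limit : Torus ℓ
  limit i = mkℝ (λ n → a i ℚ.+ lo n ℚ.* d i) (dyadic-cauchy (λ n → a i ℚ.+ lo n ℚ.* d i) ℚ.∣ d i ∣ λ n m n≤m →
    close i (lo m) (lo n) n (∣b-a∣≤w (lo≤lo n≤m) (lo≤hi n≤m)))

  uniform : ∀ ε → 0ℚ ℚ.< ε → ∃[ N ] ∀ i → dyad N ℚ.* ℚ.∣ d i ∣ ℚ.< ε
  uniform ε 0<ε with fin-bound (λ i → proj₁ (dyad*c<ε ℚ.∣ d i ∣ 0<ε))
  ... | N , p = N , λ i → ℚₚ.≤-<-trans
    (ℚₚ.*-monoʳ-≤-nonNeg ℚ.∣ d i ∣ {{ℚₚ.∣-∣-nonNeg (d i)}} (dyad-antitone (p i)))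
    (proj₂ (dyad*c<ε ℚ.∣ d i ∣ 0<ε))

  limit-near-lo : ∀ ε N → (∀ i → dyad N ℚ.* ℚ.∣ d i ∣ ℚ.< ε) → Ball limit ε (path (lo N))
  limit-near-lo ε N small i =
    Near-by-bound {ε} {dyad N ℚ.* ℚ.∣ d i ∣} {limit i} {path (lo N) i} (small i) (N , λ n N≤n →
      close i (lo n) (lo N) N (∣b-a∣≤w (lo≤lo N≤n) (lo≤hi N≤n)))

  limit-near-hi : ∀ ε N → (∀ i → dyad N ℚ.* ℚ.∣ d i ∣ ℚ.< ε) → Ball limit ε (path (lo N ℚ.+ dyad N))
  limit-near-hi ε N small i =
    Near-by-bound {ε} {dyad N ℚ.* ℚ.∣ d i ∣} {limit i} {path (lo N ℚ.+ dyad N) i} (small i) (N , λ n N≤n →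
      close i (lo n) (lo N ℚ.+ dyad N) N (∣b-a-w∣≤w (lo≤lo N≤n) (lo≤hi N≤n)))

  conclude : limit ∈ A ⊎ limit ∈ B → ∃[ u ] u ∈ U × u ∈ A × u ∈ B
  -- A ball around the limit contains both ends of a late interval. If it lies in `A`, the right end
  -- is the common point, being in `B` already; in the other case it is the left end.
  conclude (inj₁ ∈A) =
    let ε , 0<ε , ball = open-A limit ∈A
        N , small = uniform ε 0<ε
    in path (lo N ℚ.+ dyad N) , tt , ball (limit-near-hi ε N small) , B-hi N
  conclude (inj₂ ∈B) =
    let ε , 0<ε , ball = open-B limit ∈B
        N , small = uniform ε 0<ε
    in path (lo N) , tt , A-lo N , ball (limit-near-lo ε N small)

-- Retracts of the torus and separation of components

NonExpansive : ∀ {ℓ} → (Torus ℓ → Torus ℓ) → Set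
NonExpansive f = ∀ ε t s → 0ℚ ℚ.< ε → Ball t ε s → Ball (f t) ε (f s)

-- An open cover of `C` pulls back along `f` to one of the torus. That `f` fixes `C` only up to `≋`
-- is enough, because open sets respect `≋`.
retract-connected : ∀ {ℓ} {C : Pred (Torus ℓ) 0ℓ} (f : Torus ℓ → Torus ℓ) → NonExpansive f →
                    (∀ t → f t ∈ C) → (∀ t → t ∈ C → f t ≋ t) → Connected C
retract-connected {ℓ} {C} f f-ne f∈C f-fix A B open-A open-B cover (a , a∈C , a∈A) (b , b∈C , b∈B) =
  let t , _ , ft∈A , ft∈B =
        torus-connected {ℓ} (A ∘ f) (B ∘ f) (pull open-A) (pull open-B) (λ {t} _ → cover (f∈C t))
          (a , tt , back open-A a a∈C a∈A) (b , tt , back open-B b b∈C b∈B)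
  in f t , f∈C t , ft∈A , ft∈B
  where
  pull : ∀ {A} → Open A → Open (A ∘ f)
  pull open-A t ft∈A with open-A (f t) ft∈A
  ... | ε , 0<ε , ball = ε , 0<ε , λ {s} near → ball (f-ne ε t s 0<ε near)
  back : ∀ {A} → Open A → ∀ t → t ∈ C → t ∈ A → f t ∈ A
  back open-A t t∈C = Open-resp-≋ open-A (≋-sym {t = f t} {s = t} (f-fix t t∈C))

near-open : ∀ {ℓ} ε c (i : Fin ℓ) → Open (λ t → Near ε c (t i))
near-open ε c i t p =
  let η , 0<η , q = Near-open {ε} {c} {t i} p in η , 0<η , λ {u} ball → q (u i) (ball i)

-- The quarter-balls around 1 and −1 separate the two values.
two-valued⇒constant : ∀ {ℓ} {C : Pred (Torus ℓ) 0ℓ} → Connected C → ∀ i →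
  (∀ t → t ∈ C → t i ≈₁ 1₁ ⊎ t i ≈₁ ½₁) →
  ∀ {t s} → t ∈ C → t i ≈₁ 1₁ → s ∈ C → ¬ (s i ≈₁ ½₁)
two-valued⇒constant {ℓ} {C} conn i values {t} {s} t∈C t≈1 s∈C s≈½ =
  separate (½ ℚ.* ½) (half-pos (ℚₚ.positive⁻¹ ½)) (halves ½)
  where
  separate : ∀ ε → 0ℚ ℚ.< ε → ε ℚ.+ ε ≡ ½ → ⊥
  separate ε 0<ε 2ε≡½ =
    let u , _ , near1 , near½ = conn (near 1₁) (near ½₁) (near-open ε 1₁ i) (near-open ε ½₁ i) cover
          (t , t∈C , close t 1₁ t≈1) (s , s∈C , close s ½₁ s≈½)
    in 1₁≁½₁ (subst (λ ε → Near ε 1₁ ½₁) 2ε≡½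
         (Near-trans {ε} {ε} {1₁} {u i} {½₁} near1 (Near-sym {ε} {½₁} {u i} near½)))
    where
    near : 𝕊¹ → Pred (Torus ℓ) 0ℓ
    near c t = Near ε c (t i)
    close : ∀ u c → u i ≈₁ c → u ∈ near c
    close u c u≈c = ≈₁⇒Near {ε} {c} {u i} 0<ε (≈₁-sym {u i} {c} u≈c)
    cover : C ⊆ near 1₁ ∪ near ½₁
    cover {u} u∈C with values u u∈C
    ... | inj₁ u≈1 = inj₁ (close u 1₁ u≈1)
    ... | inj₂ u≈½ = inj₂ (close u ½₁ u≈½)

-- Posets of small height

variable
  c ℓ₁ ℓ₂ : Level

module _ {P : Poset c ℓ₁ ℓ₂} where
  open Poset P using (Carrier; _≈_) renaming (_≤_ to _⊑_)
  open PosetProperties P using (_<_)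

  chain-length≤1 : (∀ {x y} → x ⊑ y → x ≈ y) → ∀ xs → Linked _<_ xs → length xs ≤ 1
  chain-length≤1 h []          _                       = ℕ.z≤n
  chain-length≤1 h (_ ∷ [])    _                       = ℕ.s≤s ℕ.z≤n
  chain-length≤1 h (_ ∷ _ ∷ _) ((x⊑y , x≉y) ∷ _)       = ⊥-elim (x≉y (h x⊑y))

  chain-length≤2 : (∀ {x y z} → x ⊑ y → y ⊑ z → x ≈ y ⊎ y ≈ z) →
                   ∀ xs → Linked _<_ xs → length xs ≤ 2
  chain-length≤2 h []              _  = ℕ.z≤n
  chain-length≤2 h (_ ∷ [])        _  = ℕ.s≤s ℕ.z≤n
  chain-length≤2 h (_ ∷ _ ∷ [])    _  = ℕ.s≤s (ℕ.s≤s ℕ.z≤n)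
  chain-length≤2 h (_ ∷ _ ∷ _ ∷ _) ((x⊑y , x≉y) ∷ (y⊑z , y≉z) ∷ _) =
    ⊥-elim ([ x≉y , y≉z ]′ (h x⊑y y⊑z))

  chain-length≤3 : (∀ {w x y z} → w ⊑ x → x ⊑ y → y ⊑ z → w ≈ x ⊎ x ≈ y ⊎ y ≈ z) →
                   ∀ xs → Linked _<_ xs → length xs ≤ 3
  chain-length≤3 h []                  _  = ℕ.z≤n
  chain-length≤3 h (_ ∷ [])            _  = ℕ.s≤s ℕ.z≤n
  chain-length≤3 h (_ ∷ _ ∷ [])        _  = ℕ.s≤s (ℕ.s≤s ℕ.z≤n)
  chain-length≤3 h (_ ∷ _ ∷ _ ∷ [])    _  = ℕ.s≤s (ℕ.s≤s (ℕ.s≤s ℕ.z≤n))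
  chain-length≤3 h (_ ∷ _ ∷ _ ∷ _ ∷ _) ((w⊑x , w≉x) ∷ (x⊑y , x≉y) ∷ (y⊑z , y≉z) ∷ _) =
    ⊥-elim ([ w≉x , [ x≉y , y≉z ]′ ]′ (h w⊑x x⊑y y⊑z))

-- Says that every interval from `o` has rank at most two. The upper end `x` varies, so the property
-- passes to each `P ↓ x` unchanged.
HeightTwo : (P : Poset c ℓ₁ ℓ₂) → Poset.Carrier P → Set _
HeightTwo P o = ∀ {x y z} → y ⊑ z → z ⊑ x → y ≈ o ⊎ z ≈ x ⊎ y ≈ z
  where open Poset P using (_≈_) renaming (_≤_ to _⊑_)

module HeightTwoLattice (L : Poset c ℓ₁ ℓ₂)
  (_≤?_ : ∀ x y → Dec (Poset._≤_ L x y))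
  (o : Poset.Carrier L) (o-min : Minimum (Poset._≤_ L) o)
  (e : Poset.Carrier L) (e-max : ∀ x → Poset._≤_ L x e)
  (height : HeightTwo L o) where

  open Poset L using (Carrier; _≈_; antisym; reflexive; isPartialOrder; module Eq)
    renaming (_≤_ to _⊑_; refl to ⊑-refl; trans to ⊑-trans)

  data Comparison (x y : Carrier) : Set (c ⊔ ℓ₂) where
    below        : x ⊑ y → Comparison x y
    above        : y ⊑ x → Comparison x y
    incomparable : ¬ x ⊑ y → ¬ y ⊑ x → Comparison x y

  compare : ∀ x y → Comparison x y
  compare x y with x ≤? y | y ≤? x
  ... | yes p | _     = below p
  ... | no  _ | yes q = above q
  ... | no  p | no  q = incomparable p q

  -- Incomparable elements lie strictly between `o` and `e`, and height two leaves no room for a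
  -- bound other than these.
  _∨_ _∧_ : Carrier → Carrier → Carrier
  x ∨ y with compare x y
  ... | below _          = y
  ... | above _          = x
  ... | incomparable _ _ = e
  x ∧ y with compare x y
  ... | below _          = x
  ... | above _          = y
  ... | incomparable _ _ = o

  ∨-supremum : ∀ x y → x ⊑ (x ∨ y) × y ⊑ (x ∨ y) × (∀ z → x ⊑ z → y ⊑ z → (x ∨ y) ⊑ z)
  ∨-supremum x y with compare x y
  ... | below p          = p , ⊑-refl , λ _ _ q → q
  ... | above p          = ⊑-refl , p , λ _ q _ → q
  ... | incomparable p q = e-max x , e-max y , λ z x⊑z y⊑z → case z x⊑z y⊑z (height x⊑z (e-max z))
    where
    case : ∀ z → x ⊑ z → y ⊑ z → x ≈ o ⊎ z ≈ e ⊎ x ≈ z → e ⊑ z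
    case z x⊑z y⊑z (inj₁ x≈o)        = ⊥-elim (p (⊑-trans (reflexive x≈o) (o-min y)))
    case z x⊑z y⊑z (inj₂ (inj₁ z≈e)) = reflexive (Eq.sym z≈e)
    case z x⊑z y⊑z (inj₂ (inj₂ x≈z)) = ⊥-elim (q (⊑-trans y⊑z (reflexive (Eq.sym x≈z))))

  ∧-infimum : ∀ x y → (x ∧ y) ⊑ x × (x ∧ y) ⊑ y × (∀ z → z ⊑ x → z ⊑ y → z ⊑ (x ∧ y))
  ∧-infimum x y with compare x y
  ... | below p          = ⊑-refl , p , λ _ q _ → q
  ... | above p          = p , ⊑-refl , λ _ _ q → q
  ... | incomparable p q = o-min x , o-min y , λ z z⊑x z⊑y → case z z⊑x z⊑y (height z⊑x (e-max x))
    where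
    case : ∀ z → z ⊑ x → z ⊑ y → z ≈ o ⊎ x ≈ e ⊎ z ≈ x → z ⊑ o
    case z z⊑x z⊑y (inj₁ z≈o)        = reflexive z≈o
    case z z⊑x z⊑y (inj₂ (inj₁ x≈e)) = ⊥-elim (q (⊑-trans (e-max y) (reflexive (Eq.sym x≈e))))
    case z z⊑x z⊑y (inj₂ (inj₂ z≈x)) = ⊥-elim (p (⊑-trans (reflexive (Eq.sym z≈x)) z⊑y))

  ∧-≤ˡ : ∀ x y → (x ∧ y) ⊑ x
  ∧-≤ˡ x y = proj₁ (∧-infimum x y)
  ∧-≤ʳ : ∀ x y → (x ∧ y) ⊑ y
  ∧-≤ʳ x y = proj₁ (proj₂ (∧-infimum x y))
  ∧-glb : ∀ {x y z} → z ⊑ x → z ⊑ y → z ⊑ (x ∧ y)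
  ∧-glb {x} {y} = proj₂ (proj₂ (∧-infimum x y)) _
  ∨-≤ˡ : ∀ x y → x ⊑ (x ∨ y)
  ∨-≤ˡ x y = proj₁ (∨-supremum x y)
  ∨-≤ʳ : ∀ x y → y ⊑ (x ∨ y)
  ∨-≤ʳ x y = proj₁ (proj₂ (∨-supremum x y))
  ∨-lub : ∀ {x y z} → x ⊑ z → y ⊑ z → (x ∨ y) ⊑ z
  ∨-lub {x} {y} = proj₂ (proj₂ (∨-supremum x y)) _

  -- A failure of modularity would produce a pentagon, whose longer side is a chain of four
  -- elements. Concretely, if `w` and `z` are incomparable, then `z ⊑ y` forces `y` to be the top or
  -- equal to `z`, and the law is immediate.
  every-modular : ∀ y → IsModular L y
  every-modular y = record
    { _∨_        = _∨_
    ; _∧_        = _∧_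
    ; isLattice  = record
      { isPartialOrder = isPartialOrder ; supremum = ∨-supremum ; infimum = ∧-infimum }
    ; modularLaw = λ w z z⊑y → antisym (≤-case w z z⊑y (compare w z))
        (∨-lub (∧-glb (∧-≤ˡ y w) (⊑-trans (∧-≤ʳ y w) (∨-≤ˡ w z))) (∧-glb z⊑y (∨-≤ʳ w z)))
    }
    where
    ≤-case : ∀ w z → z ⊑ y → Comparison w z → (y ∧ (w ∨ z)) ⊑ ((y ∧ w) ∨ z)
    ≤-case w z z⊑y (below w⊑z) =
      ⊑-trans (∧-≤ʳ y (w ∨ z)) (⊑-trans (∨-lub w⊑z ⊑-refl) (∨-≤ʳ (y ∧ w) z))
    ≤-case w z z⊑y (above z⊑w) =
      ⊑-trans (∧-glb (∧-≤ˡ y (w ∨ z)) (⊑-trans (∧-≤ʳ y (w ∨ z)) (∨-lub ⊑-refl z⊑w))) (∨-≤ˡ (y ∧ w) z)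
    ≤-case w z z⊑y (incomparable w⋢z z⋢w) with height z⊑y (e-max y)
    ... | inj₁ z≈o        = ⊥-elim (z⋢w (⊑-trans (reflexive z≈o) (o-min w)))
    ... | inj₂ (inj₁ y≈e) = ⊑-trans (∧-≤ʳ y (w ∨ z)) (∨-lub
            (⊑-trans (∧-glb (⊑-trans (e-max w) (reflexive (Eq.sym y≈e))) ⊑-refl) (∨-≤ˡ (y ∧ w) z))
            (∨-≤ʳ (y ∧ w) z))
    ... | inj₂ (inj₂ z≈y) = ⊑-trans (∧-≤ˡ y (w ∨ z)) (⊑-trans (reflexive (Eq.sym z≈y)) (∨-≤ʳ (y ∧ w) z))

module _ (em : ExcludedMiddle (suc 0ℓ)) where

  em₀ : ∀ {A : Set} → Dec A
  em₀ {A} with em {Lift (suc 0ℓ) A}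
  ... | yes (lift a) = yes a
  ... | no  ¬a       = no (¬a ∘ lift)

  -- Serves both steps of the chain of ideals: `d` is either the minimum itself or covers it.
  -- Modularity is free by height, so what has to be supplied is one minimal upper bound of `d` with
  -- each outside atom, and that maximal elements lie above `d`.
  principal-mIdeal : (R : Poset (suc 0ℓ) 0ℓ 0ℓ) →
    let open Poset R using (Carrier; _≈_) renaming (_≤_ to _⊑_) in
    (o : Carrier) → Minimum _⊑_ o → HeightTwo R o →
    (d : Carrier) → (∀ {x} → x ⊑ d → x ≈ o ⊎ x ≈ d) →
    ∀ n → (∀ x → x ≈ d → HasRank (R ↓ x) n) →
    (∀ x → IsAtom R x → ¬ x ⊑ d →
      ∃[ u ] x ⊑ u × d ⊑ u × (∀ v → x ⊑ v → d ⊑ v → v ⊑ u → u ⊑ v)) →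
    (∀ x → IsMaximal R U x → d ⊑ x) →
    IsMIdeal R (λ x → x ⊑ d)
  principal-mIdeal R o o-min height d below-d n rank-d join d⊑maximal = record
    { downClosed = λ x y y⊑d x⊑y → ⊑-trans x⊑y y⊑d
    ; pure       = n , λ x (x⊑d , x-max) → rank-d x (Eq.sym (x-max d ⊑-refl x⊑d))
    ; joinClosed = joinClosed
    ; atomJoin   = atomJoin
    ; modular    = λ x x-max → d , (⊑-refl , λ y y⊑d d⊑y → antisym y⊑d d⊑y) ,
        d⊑maximal x x-max ,
        HeightTwoLattice.every-modular (R ↓ x) (λ _ _ → em₀) (o , o-min x) (λ y → o-min (proj₁ y))
          (x , ⊑-refl) proj₂ (λ y⊑z z⊑x → height y⊑z z⊑x) (d , d⊑maximal x x-max)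
    }
    where
    open Poset R using (Carrier; _≈_; antisym; reflexive; module Eq)
      renaming (_≤_ to _⊑_; refl to ⊑-refl; trans to ⊑-trans)

    joinClosed : ∀ (T : Pred Carrier 0ℓ) → T ⊆ (λ x → x ⊑ d) → ∀ u → IsMinimalUpperBound R T u → u ⊑ d
    -- Either `T` reaches `d`, and then `d` is an upper bound below `u`; or `T`, possibly empty,
    -- consists of minima, and then `o` is one.
    joinClosed T T⊑d u (u-ub , u-min) with em {∃[ t ] t ∈ T × d ⊑ t}
    ... | yes (t , t∈T , d⊑t) =
      reflexive (Eq.sym (u-min d (λ _ → T⊑d) (⊑-trans d⊑t (u-ub t t∈T))))
    ... | no none = ⊑-trans (reflexive (Eq.sym (u-min o o-ub (o-min u)))) (o-min d)
      where
      o-ub : IsUpperBound R T o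
      o-ub t t∈T with below-d (T⊑d t∈T)
      ... | inj₁ t≈o = reflexive t≈o
      ... | inj₂ t≈d = ⊥-elim (none (t , t∈T , reflexive (Eq.sym t≈d)))

    atomJoin : ∀ x y → IsAtom R x → ¬ x ⊑ d → y ⊑ d →
               ∃[ u ] IsMinimalUpperBound R (λ z → z ≈ x ⊎ z ≈ y) u
    atomJoin x y x-atom x⋢d y⊑d with below-d y⊑d
    ... | inj₁ y≈o = x ,
      (λ where t (inj₁ t≈x) → reflexive t≈x
               t (inj₂ t≈y) → ⊑-trans (reflexive (Eq.trans t≈y y≈o)) (o-min x)) ,
      λ v v-ub v⊑x → antisym v⊑x (v-ub x (inj₁ Eq.refl))
    ... | inj₂ y≈d with join x x-atom x⋢d
    ...   | u , x⊑u , d⊑u , u-min = u ,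
      (λ where t (inj₁ t≈x) → ⊑-trans (reflexive t≈x) x⊑u
               t (inj₂ t≈y) → ⊑-trans (reflexive (Eq.trans t≈y y≈d)) d⊑u) ,
      λ v v-ub v⊑u → antisym v⊑u
        (u-min v (v-ub x (inj₁ Eq.refl)) (v-ub d (inj₂ (Eq.sym y≈d))) v⊑u)

-- Chains and the modular elements of the last M-ideal

-- Elements of a restricted poset carry membership proofs, so a chain has to be equipped with them
-- before rank bounds of the restriction apply.
Σ-list : ∀ {a p} {A : Set a} {Q : Pred A p} {xs} → All Q xs → List (Σ A Q)
Σ-list []       = []
Σ-list (q ∷ qs) = (_ , q) ∷ Σ-list qs

map-Σ-list : ∀ {a p} {A : Set a} {Q : Pred A p} {xs} (qs : All Q xs) → List.map proj₁ (Σ-list qs) ≡ xs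
map-Σ-list []       = refl
map-Σ-list (q ∷ qs) = cong (_ ∷_) (map-Σ-list qs)

length-Σ-list : ∀ {a p} {A : Set a} {Q : Pred A p} {xs} (qs : All Q xs) → length (Σ-list qs) ≡ length xs
length-Σ-list []       = refl
length-Σ-list (q ∷ qs) = cong ℕ.suc (length-Σ-list qs)

module _ (P : Poset c ℓ₁ ℓ₂) where
  open Poset P using (Carrier; _≈_) renaming (_≤_ to _⊑_; refl to ⊑-refl; trans to ⊑-trans)
  open PosetProperties P using (_<_)

  ↾-chain⁺ : ∀ {q} {Q : Pred Carrier q} {xs} (qs : All Q xs) → Linked _<_ xs →
             Linked (PosetProperties._<_ (P ↾ Q)) (Σ-list qs)
  ↾-chain⁺ qs xs = Linkedₚ.map⁻ (subst (Linked _<_) (sym (map-Σ-list qs)) xs)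

  -- Used on a longest chain of an ideal: nothing in the ideal can lie above its end `z`, since the
  -- chain could then be prolonged.
  chain-end : ∀ x xs → Linked _<_ (x ∷ xs) →
              ∃[ z ] All (_⊑ z) (x ∷ xs) × z List∈.∈ (x ∷ xs) ×
              (∀ y → z < y → Linked _<_ ((x ∷ xs) ++ (y ∷ [])))
  chain-end x [] [-] = x , ⊑-refl ∷ [] , here refl , λ y x<y → x<y ∷ [-]
  chain-end x (x′ ∷ xs) (x<x′ ∷ l) with chain-end x′ xs l
  ... | z , x′⊑z ∷ all , z∈ , extend =
    z , ⊑-trans (proj₁ x<x′) x′⊑z ∷ x′⊑z ∷ all , there z∈ ,
    λ y z<y → x<x′ ∷ extend y z<y

module ModularMeet (em : ExcludedMiddle (suc 0ℓ)) (P : Poset (suc 0ℓ) 0ℓ 0ℓ) where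
  open Poset P using (Carrier; _≈_; antisym; reflexive; module Eq)
    renaming (_≤_ to _⊑_; refl to ⊑-refl; trans to ⊑-trans)
  open PosetProperties P using (_<_)

  -- What the negative direction keeps of a supersolvable chain. `meets` is the trace of modularity
  -- in corank one: joins and ranks have disappeared, and `w` of rank at least two is witnessed by
  -- `o < a < w`.
  record TopIdeal : Set (suc (suc 0ℓ)) where
    field
      ideal      : Pred Carrier 0ℓ
      downClosed : ∀ {x y} → x ⊑ y → y ∈ ideal → x ∈ ideal
      joinClosed : ∀ (T : Pred Carrier 0ℓ) → T ⊆ ideal → ∀ u → IsMinimalUpperBound P T u → u ∈ ideal
      proper     : ¬ (∀ x → x ∈ ideal)
      meets      : ∀ x → IsMaximal P U x → ∃[ y ] y ∈ ideal × y ⊑ x ×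
                   (∀ o a w → Minimum _⊑_ o → o < a → a < w → w ⊑ x →
                     ∃[ v ] v ⊑ y × v ⊑ w × ¬ v ⊑ o)

  topIdeal : Supersolvable P → ∃[ x ] (¬ Minimum _⊑_ x) → TopIdeal
  -- With `r = 0` the bottom ideal is also the top one, so every element would be a minimum.
  topIdeal record { r = ℕ.zero ; ideal = ideal ; bottom = bottom ; top = top } (x , x-not-min) =
    ⊥-elim (x-not-min (Equivalence.to (bottom x) (top x)))
  topIdeal record { r = ℕ.suc r ; ideal = ideal ; bottom = bottom ; top = top
                  ; strict = strict ; mIdeal = mIdeal ; rank = rank } _ = record
    { ideal      = Q
    ; downClosed = λ {x} {y} x⊑y y∈Q → M.downClosed (x , top x) (y , top y) y∈Q x⊑y
    ; joinClosed = λ T T⊆Q u (u-ub , u-min) → M.joinClosed (λ z → T (proj₁ z)) T⊆Q (u , top u)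
        ((λ t → u-ub (proj₁ t)) , λ v v-ub v⊑u → u-min (proj₁ v) (λ t → v-ub (t , top t)) v⊑u)
    ; proper     = λ all → proj₂ (strict (fromℕ r)) λ {x} _ → all x
    ; meets      = meets
    }
    where
    Q = ideal (inject₁ (fromℕ r))
    R = P ↾ ideal (Fin.suc (fromℕ r))
    module M = IsMIdeal (mIdeal (fromℕ r))
    n = proj₁ M.pure

    Q-rank : HasRank (P ↾ Q) r
    Q-rank = subst (HasRank (P ↾ Q)) (trans (Finₚ.toℕ-inject₁ (fromℕ r)) (Finₚ.toℕ-fromℕ r))
               (rank (inject₁ (fromℕ r)))

    R-rank : HasRank R (ℕ.suc r)
    R-rank = subst (HasRank R) (cong ℕ.suc (Finₚ.toℕ-fromℕ r)) (rank (Fin.suc (fromℕ r)))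

    P-bound : ∀ xs → Linked _<_ xs → length xs ≤ ℕ.suc (ℕ.suc r)
    P-bound xs l = subst (_≤ ℕ.suc (ℕ.suc r)) (length-Σ-list all)
      (proj₂ R-rank (Σ-list all) (↾-chain⁺ P all l))
      where
      all = All.universal top xs

    -- Purity provides a common rank `n` of the maximal elements of `Q`, not yet related to the rank
    -- `r` of `Q`. The end `z` of a longest chain in `Q` is maximal there, and the whole chain lies
    -- below it.
    r≤n : r ≤ n
    r≤n with proj₁ Q-rank
    ... | zs@(z₀ ∷ zs′) , l , len with chain-end P (proj₁ z₀) (List.map proj₁ zs′) (Linkedₚ.map⁺ l)
    ...   | z , z-ub , z-in , extend =
      ℕ.s≤s⁻¹ (subst (_≤ ℕ.suc n) (trans (length-Σ-list ubs)
          (trans (length-Σ-list tops) (trans (cong ℕ.suc (Listₚ.length-map proj₁ zs′)) len)))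
        (proj₂ (proj₂ M.pure (z , top z) (z∈Q , z-max)) (Σ-list ubs)
          (↾-chain⁺ R ubs (↾-chain⁺ P tops (Linkedₚ.map⁺ l)))))
      where
      xs = List.map proj₁ zs
      inQ : ∀ ys → All Q (List.map proj₁ ys)
      inQ []       = []
      inQ (y ∷ ys) = proj₂ y ∷ inQ ys
      z∈Q : z ∈ Q
      z∈Q = All.lookup (inQ zs) z-in
      tops : All (ideal (Fin.suc (fromℕ r))) xs
      tops = All.universal top xs
      lift-ub : ∀ {ys} (qs : All (ideal (Fin.suc (fromℕ r))) ys) → All (_⊑ z) ys →
                All (λ y → proj₁ y ⊑ z) (Σ-list qs)
      lift-ub []       []       = []
      lift-ub (_ ∷ qs) (p ∷ ps) = p ∷ lift-ub qs ps
      ubs : All (λ y → proj₁ y ⊑ z) (Σ-list tops)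
      ubs = lift-ub tops z-ub
      append : ∀ {ys y} → All Q ys → y ∈ Q → All Q (ys ++ (y ∷ []))
      append []       q = q ∷ []
      append (p ∷ ps) q = p ∷ append ps q
      z-max : ∀ y → proj₁ y ∈ Q → z ⊑ proj₁ y → proj₁ y ≈ z
      z-max (y , _) y∈Q z⊑y with em₀ em {z ≈ y}
      ... | yes z≈y = Eq.sym z≈y
      ... | no  z≉y = ⊥-elim (ℕₚ.1+n≰n (subst (_≤ ℕ.suc r) long
          (proj₂ Q-rank (Σ-list longer) (↾-chain⁺ P longer (extend y (z⊑y , z≉y))))))
        where
        longer = append (inQ zs) y∈Q
        long : length (Σ-list longer) ≡ ℕ.suc (ℕ.suc r)
        long = trans (length-Σ-list longer) (trans (Listₚ.length-++ xs)
          (trans (ℕₚ.+-comm (length xs) 1) (cong ℕ.suc (trans (Listₚ.length-map proj₁ zs) len))))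

    -- If y ∧ w were the minimum, z ↦ w ∨ z would be injective on [o, y], and
    -- prefixing o < a to the image of a longest chain would exceed the rank.
    meets : ∀ x → IsMaximal P U x → ∃[ y ] y ∈ Q × y ⊑ x ×
            (∀ o a w → Minimum _⊑_ o → o < a → a < w → w ⊑ x → ∃[ v ] v ⊑ y × v ⊑ w × ¬ v ⊑ o)
    meets x (_ , x-max) with M.modular (x , top x) (tt , λ y _ → x-max (proj₁ y) tt)
    ... | y′@(y , y∈) , y-max , y⊑x , y-modular = y , proj₁ y-max , y⊑x , meet
      where
      open IsModular y-modular
      open IsLattice isLattice using (supremum; infimum)
      L = R ↓ (x , top x)
      Y : Poset.Carrier L
      Y = y′ , y⊑x
      meet : ∀ o a w → Minimum _⊑_ o → o < a → a < w → w ⊑ x → ∃[ v ] v ⊑ y × v ⊑ w × ¬ v ⊑ o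
      meet o a w o-min o<a a<w w⊑x with em {∃[ v ] v ⊑ y × v ⊑ w × ¬ v ⊑ o}
      ... | yes found = found
      -- A longest chain below `y` has `n + 1` elements; its image preceded by `o < a` has `n + 3`.
      -- Chains of `P` have at most `r + 2`, although `r ≤ n`.
      ... | no  none  = ⊥-elim (ℕₚ.1+n≰n (ℕₚ.≤-trans (ℕ.s≤s (ℕ.s≤s (ℕ.s≤s r≤n))) too-long))
        where
        W : Poset.Carrier L
        W = (w , top w) , w⊑x
        Y∧W⊑o : proj₁ (proj₁ (Y ∧ W)) ⊑ o
        Y∧W⊑o with em₀ em {proj₁ (proj₁ (Y ∧ W)) ⊑ o}
        ... | yes p = p
        ... | no ¬p = ⊥-elim (none (_ , proj₁ (infimum Y W) , proj₁ (proj₂ (infimum Y W)) , ¬p))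
        module _ (z : Poset.Carrier (R ↓ y′)) where
          Z : Poset.Carrier L
          Z = proj₁ z , ⊑-trans (proj₂ z) y⊑x
          f : Carrier
          f = proj₁ (proj₁ (W ∨ Z))
          w⊑f : w ⊑ f
          w⊑f = proj₁ (supremum W Z)
          -- The modular law turns `y ∧ (w ∨ z)` into `(y ∧ w) ∨ z`, and `y ∧ w` is minimal. Thus
          -- `f` has a left inverse, which makes it strictly monotone.
          recover : proj₁ (proj₁ (Y ∧ (W ∨ Z))) ≈ proj₁ (proj₁ z)
          recover = Eq.trans (modularLaw W Z (proj₂ z)) (antisym
            (proj₂ (proj₂ (supremum (Y ∧ W) Z)) Z (⊑-trans Y∧W⊑o (o-min _)) ⊑-refl)
            (proj₁ (proj₂ (supremum (Y ∧ W) Z))))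
        ∧-mono : ∀ A B → Poset._≤_ L A B → Poset._≤_ L (Y ∧ A) (Y ∧ B)
        ∧-mono A B A⊑B = proj₂ (proj₂ (infimum Y B)) (Y ∧ A) (proj₁ (infimum Y A))
          (⊑-trans (proj₁ (proj₂ (infimum Y A))) A⊑B)
        f-mono : ∀ z z′ → proj₁ (proj₁ z) < proj₁ (proj₁ z′) → f z < f z′
        f-mono z z′ (z⊑z′ , z≉z′) =
          proj₂ (proj₂ (supremum W (Z z))) (W ∨ Z z′) (w⊑f z′)
            (⊑-trans z⊑z′ (proj₁ (proj₂ (supremum W (Z z′))))) ,
          λ fz≈fz′ → z≉z′ (Eq.trans (Eq.sym (recover z)) (Eq.trans (antisym
            (∧-mono (W ∨ Z z) (W ∨ Z z′) (reflexive fz≈fz′))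
            (∧-mono (W ∨ Z z′) (W ∨ Z z) (reflexive (Eq.sym fz≈fz′)))) (recover z′)))
        <-≤ : ∀ {a b c} → a < b → b ⊑ c → a < c
        <-≤ (a⊑b , a≉b) b⊑c = ⊑-trans a⊑b b⊑c ,
          λ a≈c → a≉b (antisym a⊑b (⊑-trans b⊑c (reflexive (Eq.sym a≈c))))
        too-long : ℕ.suc (ℕ.suc (ℕ.suc n)) ≤ ℕ.suc (ℕ.suc r)
        too-long with proj₁ (proj₂ M.pure y′ y-max)
        ... | zs@(z₀ ∷ zs′) , l , len =
          subst (λ k → ℕ.suc (ℕ.suc k) ≤ ℕ.suc (ℕ.suc r)) (trans (Listₚ.length-map f zs) len)
            (P-bound (o ∷ a ∷ List.map f zs)
              (o<a ∷ <-≤ a<w (w⊑f z₀) ∷ Linkedₚ.map⁺ (Linked.map (λ {z} {z′} → f-mono z z′) l)))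

-- Characters of B type

-- The Boolean is the sign of the second index, so that the roots `ε i + ε j` and `ε i − ε j` are
-- treated together.
pair : Bool → 𝕊¹ → 𝕊¹ → 𝕊¹
pair true  x y = x · y
pair false x y = x · y ⁻¹

solution : Bool → 𝕊¹ → 𝕊¹
solution true  x = x ⁻¹
solution false x = x

open +-*-Solver using (solve; _:=_; _:+_; _:-_; :-_; con)

pair-≈ : ∀ σ {x x′ y y′} → x ≈₁ x′ → y ≈₁ y′ → pair σ x y ≈₁ pair σ x′ y′
pair-≈ true {x} {x′} {y} {y′} p q = ≈₁-+ {x} {x′} {y} {y′} {x · y} {x′ · y′} p q λ n →
  solve 4 (λ x x′ y y′ → (x :+ y) :- (x′ :+ y′) := (x :- x′) :+ (y :- y′)) refl
    (seq x n) (seq x′ n) (seq y n) (seq y′ n)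
pair-≈ false {x} {x′} {y} {y′} p q =
  ≈₁-+ {x} {x′} {y′} {y} {x · y ⁻¹} {x′ · y′ ⁻¹} p (≈₁-sym {y} {y′} q) λ n →
  solve 4 (λ x x′ y y′ → (x :+ (:- y)) :- (x′ :+ (:- y′)) := (x :- x′) :+ (y′ :- y)) refl
    (seq x n) (seq x′ n) (seq y n) (seq y′ n)

pair-11 : ∀ σ {x y} → x ≈₁ 1₁ → y ≈₁ 1₁ → pair σ x y ≈₁ 1₁
pair-11 true  {x} {y} p q = ≈₁-+ {x} {1₁} {y} {1₁} {x · y} {1₁} p q λ n →
  solve 2 (λ x y → (x :+ y) :- con 0ℚ := (x :- con 0ℚ) :+ (y :- con 0ℚ)) refl (seq x n) (seq y n)
pair-11 false {x} {y} p q = ≈₁-+ {x} {1₁} {1₁} {y} {x · y ⁻¹} {1₁} p (≈₁-sym {y} {1₁} q) λ n →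
  solve 2 (λ x y → (x :+ (:- y)) :- con 0ℚ := (x :- con 0ℚ) :+ (con 0ℚ :- y)) refl (seq x n) (seq y n)

pair-½½ : ∀ σ {x y} → x ≈₁ ½₁ → y ≈₁ ½₁ → pair σ x y ≈₁ 1₁
pair-½½ true  {x} {y} p q =
  ≈₁-trans {x · y} {½₁ · ½₁} {1₁} (pair-≈ true {x} {½₁} {y} {½₁} p q)
    (≈₁-by-ι {½₁ · ½₁} {1₁} (+ 1) λ _ → refl)
pair-½½ false {x} {y} p q =
  ≈₁-trans {x · y ⁻¹} {½₁ · ½₁ ⁻¹} {1₁} (pair-≈ false {x} {½₁} {y} {½₁} p q)
    (≈₁-by-≡ {½₁ · ½₁ ⁻¹} {1₁} λ _ → refl)

pair-cancelʳ : ∀ σ {x y} → pair σ x y ≈₁ 1₁ → y ≈₁ 1₁ → x ≈₁ 1₁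
pair-cancelʳ true {x} {y} p q = ≈₁-+ {x · y} {1₁} {1₁} {y} {x} {1₁} p (≈₁-sym {y} {1₁} q) λ n →
  solve 2 (λ x y → x :- con 0ℚ := ((x :+ y) :- con 0ℚ) :+ (con 0ℚ :- y)) refl (seq x n) (seq y n)
pair-cancelʳ false {x} {y} p q = ≈₁-+ {x · y ⁻¹} {1₁} {y} {1₁} {x} {1₁} p q λ n →
  solve 2 (λ x y → x :- con 0ℚ := ((x :+ (:- y)) :- con 0ℚ) :+ (y :- con 0ℚ)) refl (seq x n) (seq y n)

pair-sym : ∀ σ {x y} → pair σ x y ≈₁ 1₁ → pair σ y x ≈₁ 1₁
pair-sym true {x} {y} p =
  ≈₁-trans {y · x} {x · y} {1₁} (≈₁-by-≡ {y · x} {x · y} λ n → ℚₚ.+-comm (seq y n) (seq x n)) p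
pair-sym false {x} {y} p = ≈₁-neg {x · y ⁻¹} {1₁} {y · x ⁻¹} {1₁} p λ n →
  solve 2 (λ x y → (y :+ (:- x)) :- con 0ℚ := :- ((x :+ (:- y)) :- con 0ℚ)) refl (seq x n) (seq y n)

pair-cancelˡ : ∀ σ {x y} → pair σ x y ≈₁ 1₁ → x ≈₁ 1₁ → y ≈₁ 1₁
pair-cancelˡ σ {x} {y} p q = pair-cancelʳ σ {y} {x} (pair-sym σ {x} {y} p) q

pair-solution : ∀ σ x → pair σ x (solution σ x) ≈₁ 1₁
pair-solution true  x = ≈₁-by-≡ {x · x ⁻¹} {1₁} λ n → ℚₚ.+-inverseʳ (seq x n)
pair-solution false x = ≈₁-by-≡ {x · x ⁻¹} {1₁} λ n → ℚₚ.+-inverseʳ (seq x n)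

solution-unique : ∀ σ {x y} → pair σ x y ≈₁ 1₁ → solution σ x ≈₁ y
solution-unique true {x} {y} p = ≈₁-neg {x · y} {1₁} {x ⁻¹} {y} p λ n →
  solve 2 (λ x y → (:- x) :- y := :- ((x :+ y) :- con 0ℚ)) refl (seq x n) (seq y n)
solution-unique false {x} {y} p = ≈₁-+ {x · y ⁻¹} {1₁} {1₁} {1₁} {x} {y} p (≈₁-refl {1₁}) λ n →
  solve 2 (λ x y → x :- y := ((x :+ (:- y)) :- con 0ℚ) :+ (con 0ℚ :- con 0ℚ)) refl (seq x n) (seq y n)

-- The product of the two characters is `x · x`: together they cut out a disconnected set, on which
-- `x` may be 1 or -1.
both-pairs⇒square : ∀ {x y} → pair true x y ≈₁ 1₁ → pair false x y ≈₁ 1₁ → x · x ≈₁ 1₁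
both-pairs⇒square {x} {y} p q = ≈₁-+ {x · y} {1₁} {x · y ⁻¹} {1₁} {x · x} {1₁} p q λ n →
  solve 2 (λ x y → (x :+ x) :- con 0ℚ := ((x :+ y) :- con 0ℚ) :+ ((x :+ (:- y)) :- con 0ℚ)) refl
    (seq x n) (seq y n)

-- The two solutions `x` and `x ⁻¹` coincide exactly when `x · x = 1`, so telling the signs apart
-- takes a point of order four; at ±1 they agree.
opposite-solution : ∀ σ τ {x} → σ ≢ τ → x · x ≈₁ ½₁ → ¬ (pair τ x (solution σ x) ≈₁ 1₁)
opposite-solution true  true  σ≢τ _ _ = σ≢τ refl
opposite-solution false false σ≢τ _ _ = σ≢τ refl
opposite-solution false true {x} _ p q =
  ½₁≉1₁ (≈₁-trans {½₁} {x · x} {1₁} (≈₁-sym {x · x} {½₁} p) q)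
opposite-solution true false {x} _ p q =
  ½₁≉1₁ (≈₁-trans {½₁} {x · x} {1₁} (≈₁-sym {x · x} {½₁} p)
    (≈₁-trans {x · x} {x · x ⁻¹ ⁻¹} {1₁}
      (≈₁-by-≡ {x · x} {x · x ⁻¹ ⁻¹} λ n → solve 1 (λ x → x :+ x := x :+ (:- (:- x))) refl (seq x n)) q))

square-root-of-½₁ : ∃[ x ] x · x ≈₁ ½₁
square-root-of-½₁ = fromℚ (½ ℚ.* ½) ,
  ≈₁-by-≡ {fromℚ (½ ℚ.* ½) · fromℚ (½ ℚ.* ½)} {½₁} (λ _ → halves ½)

-- Subtori as images of coordinate maps

-- A syntax for coordinate maps. The proper layers constructed below are images of such maps, and
-- non-expansiveness is checked once, entry by entry.
data Entry (ℓ : ℕ) : Set where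
  one half : Entry ℓ
  var      : Fin ℓ → Entry ℓ
  solve-for : Bool → Fin ℓ → Entry ℓ

eval : ∀ {ℓ} → Entry ℓ → Torus ℓ → 𝕊¹
eval one             t = 1₁
eval half            t = ½₁
eval (var i)         t = t i
eval (solve-for σ i) t = solution σ (t i)

evalAll : ∀ {ℓ} → (Fin ℓ → Entry ℓ) → Torus ℓ → Torus ℓ
evalAll e t i = eval (e i) t

evalAll-nonExpansive : ∀ {ℓ} (e : Fin ℓ → Entry ℓ) → NonExpansive (evalAll e)
evalAll-nonExpansive e ε t s 0<ε near i = go (e i)
  where
  go : ∀ x → Near ε (eval x t) (eval x s)
  go one                 = Near-refl {ε} {1₁} 0<ε
  go half                = Near-refl {ε} {½₁} 0<ε
  go (var i)             = near i
  go (solve-for true i)  = Near-neg {ε} {t i} {s i} {t i ⁻¹} {s i ⁻¹} (near i) λ n →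
    solve 2 (λ t s → (:- t) :- (:- s) := :- (t :- s)) refl (seq (t i) n) (seq (s i) n)
  go (solve-for false i) = near i

infixl 6 _[_↦_]
_[_↦_] : ∀ {a} {A : Set a} {ℓ} → (Fin ℓ → A) → Fin ℓ → A → Fin ℓ → A
(f [ i ↦ x ]) j with i Finₚ.≟ j
... | yes _ = x
... | no  _ = f j

update-≡ : ∀ {a} {A : Set a} {ℓ} (f : Fin ℓ → A) i x → (f [ i ↦ x ]) i ≡ x
update-≡ f i x with i Finₚ.≟ i
... | yes _  = refl
... | no i≢i = ⊥-elim (i≢i refl)

update-≢ : ∀ {a} {A : Set a} {ℓ} (f : Fin ℓ → A) {i j} x → i ≢ j → (f [ i ↦ x ]) j ≡ f j
update-≢ f {i} {j} x i≢j with i Finₚ.≟ j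
... | yes i≡j = ⊥-elim (i≢j i≡j)
... | no  _   = refl

ones : ∀ {ℓ} → Torus ℓ
ones _ = 1₁

½s : ∀ {ℓ} → Torus ℓ
½s _ = ½₁

≡⇒≈₁ : ∀ {x y} → x ≡ y → x ≈₁ y
≡⇒≈₁ {x} refl = ≈₁-refl {x}

-- Layers of the arrangement of type B

module LayersB (ℓ : ℕ) where

  H : Arrangement (PositiveRootB ℓ) ℓ
  H = arrangementB ℓ

  open Poset (layers H) public using ()
    renaming (_≤_ to _⊑_; _≈_ to _≅_; refl to ⊑-refl; reflexive to ⊑-reflexive;
              antisym to ⊑-antisym; trans to ⊑-trans; module Eq to ≅)
  open PosetProperties (layers H) public using () renaming (_<_ to _⊏_)
  open Layer public using (points)

  -- Both orders of the indices are allowed here, unlike in PositiveRootB.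
  Pair : Bool → Fin ℓ → Fin ℓ → Pred (Torus ℓ) 0ℓ
  Pair σ i j t = pair σ (t i) (t j) ≈₁ 1₁

  Pair-sym : ∀ σ i j → Pair σ i j ⊆ Pair σ j i
  Pair-sym σ i j {t} = pair-sym σ {t i} {t j}

  rootOf : Bool → (i j : Fin ℓ) → i Fin.< j → PositiveRootB ℓ
  rootOf true  = plus
  rootOf false = minus

  H-rootOf : ∀ σ i j i<j → H (rootOf σ i j i<j) ⊆ Pair σ i j × Pair σ i j ⊆ H (rootOf σ i j i<j)
  H-rootOf true  i j i<j = id , id
  H-rootOf false i j i<j = id , id

  pairRoot : ∀ σ {i j} → i ≢ j → ∃[ α ] H α ⊆ Pair σ i j × Pair σ i j ⊆ H α
  pairRoot σ {i} {j} i≢j with ℕₚ.<-cmp (toℕ i) (toℕ j)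
  ... | tri< i<j _ _ = rootOf σ i j i<j , H-rootOf σ i j i<j
  ... | tri≈ _ i≡j _ = ⊥-elim (i≢j (Finₚ.toℕ-injective i≡j))
  ... | tri> _ _ j<i = rootOf σ j i j<i ,
    (λ {t} p → Pair-sym σ j i {t} (proj₁ (H-rootOf σ j i j<i) {t} p)) ,
    (λ {t} p → proj₂ (H-rootOf σ j i j<i) {t} (Pair-sym σ i j {t} p))

  data RootView (α : PositiveRootB ℓ) : Set where
    isShort : ∀ i → α ≡ short i → RootView α
    isPair  : ∀ σ i j → i ≢ j → H α ⊆ Pair σ i j → RootView α

  rootView : ∀ α → RootView α
  rootView (short i)       = isShort i refl
  rootView (plus i j i<j)  = isPair true i j (λ { refl → ℕₚ.<-irrefl refl i<j }) id
  rootView (minus i j i<j) = isPair false i j (λ { refl → ℕₚ.<-irrefl refl i<j }) id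

  H-resp : ∀ α {t s} → t ≋ s → t ∈ H α → s ∈ H α
  H-resp (short i) {t} {s} t≋s p = ≈₁-trans {s i} {t i} {1₁} (≈₁-sym {t i} {s i} (t≋s i)) p
  H-resp (plus i j _) {t} {s} t≋s p = ≈₁-trans {s i · s j} {t i · t j} {1₁}
    (pair-≈ true {s i} {t i} {s j} {t j} (≈₁-sym {t i} {s i} (t≋s i)) (≈₁-sym {t j} {s j} (t≋s j))) p
  H-resp (minus i j _) {t} {s} t≋s p = ≈₁-trans {s i · s j ⁻¹} {t i · t j ⁻¹} {1₁}
    (pair-≈ false {s i} {t i} {s j} {t j} (≈₁-sym {t i} {s i} (t≋s i)) (≈₁-sym {t j} {s j} (t≋s j))) p

  ones∈H : ∀ α → ones ∈ H α
  ones∈H (short i)     = ≈₁-refl {1₁}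
  ones∈H (plus i j _)  = pair-11 true {1₁} {1₁} (≈₁-refl {1₁}) (≈₁-refl {1₁})
  ones∈H (minus i j _) = pair-11 false {1₁} {1₁} (≈₁-refl {1₁}) (≈₁-refl {1₁})

  Containing : Pred (Torus ℓ) 0ℓ → Pred (PositiveRootB ℓ) 0ℓ
  Containing C α = C ⊆ H α

  -- Taking all roots whose hypertorus contains `C` makes the ambient intersection as small as
  -- possible, hence maximality as easy as possible.
  component : (C : Pred (Torus ℓ) 0ℓ) → ∃[ t ] t ∈ C → Connected C →
              (∀ D → Connected D → C ⊆ D → D ⊆ Intersection H (Containing C) → D ⊆ C) → Layer H
  component C nonempty connected maximal = record
    { subset      = Containing C
    ; points      = C
    ; isComponent = record
      { nonempty = nonempty ; contained = λ t∈C α C⊆H → C⊆H t∈C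
      ; connected = connected ; maximal = maximal } }

  -- The case of a connected intersection. Layers such as (-1, ..., -1), which are proper
  -- components, need `component` instead.
  flat : (C : Pred (Torus ℓ) 0ℓ) → ∃[ t ] t ∈ C → Connected C →
         Intersection H (Containing C) ⊆ C → Layer H
  flat C nonempty connected closed = component C nonempty connected λ D _ _ D⊆ t∈D → closed (D⊆ t∈D)

  module _ (X : Layer H) where
    open IsConnectedComponent (Layer.isComponent X)

    -- The saturation under `≋` is still connected, because open sets are saturated, and it stays in
    -- the intersection; maximality absorbs it.
    points-resp : ∀ {t s} → t ≋ s → t ∈ points X → s ∈ points X
    points-resp {t} {s} t≋s t∈X = maximal Saturation sat-connected
      (λ {u} u∈X → u , u∈X , ≋-refl {t = u})
      (λ {u} (v , v∈X , v≋u) α α∈ → H-resp α v≋u (contained v∈X α α∈)) {s} (t , t∈X , t≋s)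
      where
      Saturation : Pred (Torus ℓ) 0ℓ
      Saturation u = ∃[ v ] v ∈ points X × v ≋ u
      sat-connected : Connected Saturation
      sat-connected A B oA oB cover (a , (a′ , a′∈ , a′≋a) , a∈A) (b , (b′ , b′∈ , b′≋b) , b∈B) =
        let u , u∈X , u∈A , u∈B = connected A B oA oB (λ {u} u∈X → cover {u} (u , u∈X , ≋-refl {t = u}))
              (a′ , a′∈ , Open-resp-≋ oA (≋-sym {t = a′} {s = a} a′≋a) a∈A)
              (b′ , b′∈ , Open-resp-≋ oB (≋-sym {t = b′} {s = b} b′≋b) b∈B)
        in u , (u , u∈X , ≋-refl {t = u}) , u∈A , u∈B

    ∈H : ∀ α → α ∈ Layer.subset X → points X ⊆ H α
    ∈H α α∈ t∈X = contained t∈X α α∈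

    subset-empty⇒bottom : (∀ α → α ∉ Layer.subset X) → ∀ t → t ∈ points X
    subset-empty⇒bottom none t =
      maximal U torus-connected (λ _ → tt) (λ _ α α∈ → ⊥-elim (none α α∈)) tt

  -- A layer above `X` is nonempty and saturated, so it contains the single `≋`-class that `X`
  -- consists of.
  singleton-maximal : ∀ X → (∀ {t s} → t ∈ points X → s ∈ points X → t ≋ s) → IsMaximal (layers H) U X
  singleton-maximal X single = tt , λ Y _ X⊑Y →
    let y , y∈Y = IsConnectedComponent.nonempty (Layer.isComponent Y)
    in ⊑-antisym {Y} {X} (λ {t} t∈X → points-resp Y (single {y} {t} (X⊑Y y∈Y) t∈X) y∈Y) X⊑Y

  whole : Layer H
  whole = flat U (ones , tt) torus-connected (λ _ → tt)

  whole-min : Minimum _⊑_ whole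
  whole-min _ _ = tt

  evalAll-connected : ∀ {C : Pred (Torus ℓ) 0ℓ} e → (∀ t → evalAll e t ∈ C) →
                      (∀ t → t ∈ C → evalAll e t ≋ t) → Connected C
  evalAll-connected e = retract-connected (evalAll e) (evalAll-nonExpansive e)

  private
    update-fix : ∀ (e : Fin ℓ → Entry ℓ) i x t → eval x t ≈₁ t i → (∀ j → i ≢ j → eval (e j) t ≈₁ t j) →
                 evalAll (e [ i ↦ x ]) t ≋ t
    update-fix e i x t at-i off-i j with i Finₚ.≟ j
    ... | yes refl = at-i
    ... | no i≢j   = off-i j i≢j

    at : ∀ (e : Fin ℓ → Entry ℓ) i x t → evalAll (e [ i ↦ x ]) t i ≡ eval x t
    at e i x t = cong (λ x → eval x t) (update-≡ e i x)

    off : ∀ (e : Fin ℓ → Entry ℓ) {i} x t {j} → i ≢ j → evalAll (e [ i ↦ x ]) t j ≡ eval (e j) t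
    off e {i} x t i≢j = cong (λ x → eval x t) (update-≢ e x i≢j)

  Pair-≡ : ∀ σ {i j} (t : Torus ℓ) {x y} → t i ≡ x → t j ≡ y → Pair σ i j t → pair σ x y ≈₁ 1₁
  Pair-≡ σ t refl refl p = p

  Pair-≡⁻ : ∀ σ {i j} (t : Torus ℓ) x y → t i ≡ x → t j ≡ y → pair σ x y ≈₁ 1₁ → Pair σ i j t
  Pair-≡⁻ σ t x y refl refl p = p

  hyperplane-connected : ∀ α → Connected (H α)
  hyperplane-connected (short i) = evalAll-connected (var [ i ↦ one ])
    (λ t → ≡⇒≈₁ (at var i one t))
    (λ t p → update-fix var i one t (≈₁-sym {t i} {1₁} p) λ j _ → ≈₁-refl {t j})
  hyperplane-connected (plus i j i<j) = evalAll-connected (var [ j ↦ solve-for true i ])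
    (λ t → Pair-≡⁻ true {i} {j} (evalAll (var [ j ↦ solve-for true i ]) t) (t i) (solution true (t i))
      (off var (solve-for true i) t j≢i) (at var j (solve-for true i) t) (pair-solution true (t i)))
    (λ t p → update-fix var j (solve-for true i) t (solution-unique true {t i} {t j} p) λ k _ → ≈₁-refl {t k})
    where
    j≢i : j ≢ i
    j≢i refl = ℕₚ.<-irrefl refl i<j
  hyperplane-connected (minus i j i<j) = evalAll-connected (var [ j ↦ solve-for false i ])
    (λ t → Pair-≡⁻ false {i} {j} (evalAll (var [ j ↦ solve-for false i ]) t) (t i) (solution false (t i))
      (off var (solve-for false i) t j≢i) (at var j (solve-for false i) t) (pair-solution false (t i)))
    (λ t p → update-fix var j (solve-for false i) t (solution-unique false {t i} {t j} p) λ k _ → ≈₁-refl {t k})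
    where
    j≢i : j ≢ i
    j≢i refl = ℕₚ.<-irrefl refl i<j

  hyperplane : PositiveRootB ℓ → Layer H
  hyperplane α = flat (H α) (ones , ones∈H α) (hyperplane-connected α) (λ t∈ → t∈ α id)

  origin : Layer H
  origin = flat (λ t → t ≋ ones) (ones , ≋-refl {t = ones})
    (evalAll-connected (λ _ → one) (λ _ → ≋-refl {t = ones}) (λ t p → ≋-sym {t = t} {s = ones} p))
    (λ t∈ i → t∈ (short i) (λ p → p i))

  hyperplane⊑origin : ∀ α → hyperplane α ⊑ origin
  hyperplane⊑origin α {t} p = H-resp α (≋-sym {t = t} {s = ones} p) (ones∈H α)

  H-proper : ∀ α → ¬ (∀ t → t ∈ H α)
  H-proper α all with rootView α
  ... | isShort i refl = ½₁≉1₁ (all ½s)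
  ... | isPair σ i j i≢j H⊆ = ½₁≉1₁ (pair-cancelʳ σ {½₁} {1₁}
    (Pair-≡ σ {i} {j} v (update-≡ ones i ½₁) (update-≢ ones ½₁ i≢j) (H⊆ (all v))) (≈₁-refl {1₁}))
    where v = ones [ i ↦ ½₁ ]

  whole⊏hyperplane : ∀ α → whole ⊏ hyperplane α
  whole⊏hyperplane α = (λ _ → tt) , λ eq →
    H-proper α λ t → ⊑-reflexive {hyperplane α} {whole} (≅.sym {whole} {hyperplane α} eq) {t} tt

  module ShortPair (σ : Bool) {i j k : Fin ℓ} (i≢j : i ≢ j) (i≢k : i ≢ k) (j≢k : j ≢ k) where

    entries : Fin ℓ → Entry ℓ
    entries = (var [ k ↦ solve-for σ j ]) [ i ↦ one ]

    C : Pred (Torus ℓ) 0ℓ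
    C t = t i ≈₁ 1₁ × Pair σ j k t

    at-i : ∀ t → evalAll entries t i ≡ 1₁
    at-i t = at (var [ k ↦ solve-for σ j ]) i one t

    at-k : ∀ t → evalAll entries t k ≡ solution σ (t j)
    at-k t = trans (off (var [ k ↦ solve-for σ j ]) one t i≢k) (at var k (solve-for σ j) t)

    at-other : ∀ t {m} → i ≢ m → k ≢ m → evalAll entries t m ≡ t m
    at-other t i≢m k≢m = trans (off (var [ k ↦ solve-for σ j ]) one t i≢m) (off var (solve-for σ j) t k≢m)

    entries∈C : ∀ t → evalAll entries t ∈ C
    entries∈C t = ≡⇒≈₁ (at-i t) ,
      Pair-≡⁻ σ {j} {k} (evalAll entries t) (t j) (solution σ (t j)) (at-other t i≢j (j≢k ∘ sym)) (at-k t) (pair-solution σ (t j))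

    layer : Layer H
    layer = flat C (evalAll entries ones , entries∈C ones)
      (evalAll-connected entries entries∈C λ t (ti≈1 , tjk) →
        update-fix (var [ k ↦ solve-for σ j ]) i one t (≈₁-sym {t i} {1₁} ti≈1) λ m _ →
        update-fix var k (solve-for σ j) t (solution-unique σ {t j} {t k} tjk) (λ n _ → ≈₁-refl {t n}) m)
      (λ {t} t∈ → t∈ (short i) proj₁ ,
        proj₁ (proj₂ (pairRoot σ j≢k)) (t∈ _ (λ {s} s∈C → proj₂ (proj₂ (pairRoot σ j≢k)) {s} (proj₂ s∈C))))

    hyperplane⊏layer : hyperplane (short i) ⊏ layer
    hyperplane⊏layer = proj₁ , λ eq → ½₁≉1₁ (pair-cancelʳ σ {½₁} {1₁}
      (Pair-≡ σ {j} {k} v (update-≡ ones j ½₁) (update-≢ ones ½₁ j≢k)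
        (proj₂ (⊑-reflexive {layer} {hyperplane (short i)} (≅.sym {hyperplane (short i)} {layer} eq) {v} v∈)))
      (≈₁-refl {1₁}))
      where
      v = ones [ j ↦ ½₁ ]
      v∈ : v i ≈₁ 1₁
      v∈ = ≡⇒≈₁ (update-≢ ones ½₁ (i≢j ∘ sym))

    layer⊑origin : layer ⊑ origin
    layer⊑origin {t} t≋1 = t≋1 i , pair-11 σ {t j} {t k} (t≋1 j) (t≋1 k)

    private
      -- Evaluating at 1, ½, and a fourth root of unity excludes all other roots.
      not-one : ∀ {m} → i ≢ m → ¬ (evalAll entries ½s m ≈₁ 1₁)
      not-one {m} i≢m p with k Finₚ.≟ m
      ... | no k≢m   = ½₁≉1₁ (≈₁-trans {½₁} {evalAll entries ½s m} {1₁} (≡⇒≈₁ (sym (at-other ½s i≢m k≢m))) p)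
      ... | yes refl = ½₁≉1₁ (pair-cancelʳ σ {½₁} {solution σ ½₁} (pair-solution σ ½₁)
          (≈₁-trans {solution σ ½₁} {evalAll entries ½s k} {1₁} (≡⇒≈₁ (sym (at-k ½s))) p))

      -- The test point has -1 at `a` alone, and its retraction keeps -1 at `a` and 1 at `b`. If `b`
      -- is the solved coordinate `k`, its value comes from `j`, whence the condition `j ≢ a`.
      only-one-half : ∀ τ a b → C ⊆ Pair τ a b → i ≢ a → i ≢ b → k ≢ a → a ≢ b → (k ≡ b → j ≢ a) → ⊥
      only-one-half τ a b C⊆ i≢a i≢b k≢a a≢b k≡b⇒j≢a = ½₁≉1₁ (pair-cancelʳ τ {½₁} {evalAll entries v b}
        (Pair-≡ τ {a} {b} (evalAll entries v) (trans (at-other v i≢a k≢a) (update-≡ ones a ½₁)) refl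
          (C⊆ {evalAll entries v} (entries∈C v)))
        vb≈1)
        where
        v = ones [ a ↦ ½₁ ]
        vb≈1 : evalAll entries v b ≈₁ 1₁
        vb≈1 with k Finₚ.≟ b
        ... | no k≢b = ≡⇒≈₁ (trans (at-other v i≢b k≢b) (update-≢ ones ½₁ a≢b))
        ... | yes refl = ≈₁-trans {evalAll entries v k} {solution σ (v j)} {1₁} (≡⇒≈₁ (at-k v))
          (pair-cancelˡ σ {v j} {solution σ (v j)} (pair-solution σ (v j))
            (≡⇒≈₁ (update-≢ ones ½₁ (k≡b⇒j≢a refl ∘ sym))))

      matching : ∀ τ → C ⊆ Pair τ j k → σ ≡ τ
      matching τ C⊆ with σ Boolₚ.≟ τ
      ... | yes σ≡τ = σ≡τ
      ... | no  σ≢τ =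
        let x , x²≈½ = square-root-of-½₁
            v = λ _ → x
        in ⊥-elim (opposite-solution σ τ {x} σ≢τ x²≈½
             (Pair-≡ τ {j} {k} (evalAll entries v) (at-other v i≢j (j≢k ∘ sym)) (at-k v)
               (C⊆ {evalAll entries v} (entries∈C v))))

    -- The span of `ε i` and `ε j ± ε k` contains no further positive roots (type A₁ × A₁). A
    -- hypertorus through both this layer and a modular element is therefore one of two.
    roots : ∀ α → C ⊆ H α → H α ⊆ H (short i) ⊎ H α ⊆ Pair σ j k
    roots α C⊆H with rootView α
    ... | isShort m refl with i Finₚ.≟ m
    ...   | yes refl = inj₁ id
    ...   | no i≢m   = ⊥-elim (not-one i≢m (C⊆H {evalAll entries ½s} (entries∈C ½s)))
    roots α C⊆H | isPair τ a b a≢b H⊆ with i Finₚ.≟ a | i Finₚ.≟ b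
    ... | yes refl | _ = ⊥-elim (not-one a≢b (pair-cancelˡ τ {1₁} {evalAll entries ½s b}
            (Pair-≡ τ {a} {b} (evalAll entries ½s) (at-i ½s) refl (H⊆ (C⊆H {evalAll entries ½s} (entries∈C ½s)))) (≈₁-refl {1₁})))
    ... | no _ | yes refl = ⊥-elim (not-one (a≢b ∘ sym) (pair-cancelʳ τ {evalAll entries ½s a} {1₁}
            (Pair-≡ τ {a} {b} (evalAll entries ½s) refl (at-i ½s) (H⊆ (C⊆H {evalAll entries ½s} (entries∈C ½s)))) (≈₁-refl {1₁})))
    ... | no i≢a | no i≢b with j Finₚ.≟ a | k Finₚ.≟ b | j Finₚ.≟ b | k Finₚ.≟ a
    ...   | yes refl | yes refl | _ | _ with matching τ (H⊆ ∘ C⊆H)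
    ...     | refl = inj₂ H⊆
    roots α C⊆H | isPair τ a b a≢b H⊆ | no i≢a | no i≢b | _ | _ | yes refl | yes refl
      with matching τ (λ {t} t∈C → Pair-sym τ a b {t} (H⊆ (C⊆H t∈C)))
    ... | refl = inj₂ (λ {t} t∈H → Pair-sym τ a b {t} (H⊆ t∈H))
    roots α C⊆H | isPair τ a b a≢b H⊆ | no i≢a | no i≢b | _ | _ | no j≢b | yes refl =
      ⊥-elim (only-one-half τ b a (λ {t} t∈C → Pair-sym τ a b {t} (H⊆ (C⊆H t∈C)))
        i≢b i≢a a≢b (a≢b ∘ sym) (λ _ → j≢b))
    roots α C⊆H | isPair τ a b a≢b H⊆ | no i≢a | no i≢b | no j≢a | _ | _ | no k≢a =
      ⊥-elim (only-one-half τ a b (H⊆ ∘ C⊆H) i≢a i≢b k≢a a≢b (λ _ → j≢a))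
    roots α C⊆H | isPair τ a b a≢b H⊆ | no i≢a | no i≢b | yes _ | no k≢b | _ | no k≢a =
      ⊥-elim (only-one-half τ a b (H⊆ ∘ C⊆H) i≢a i≢b k≢a a≢b (λ k≡b → ⊥-elim (k≢b k≡b)))

  -- A partner j of i yields t i · t j = t i · (t j)⁻¹ = 1, so that t i = ±1 on every
  -- larger connected subset of the intersection.
  module Half (S : Fin ℓ → Bool) (partner : ∀ i → S i ≡ true → ∃[ j ] i ≢ j × S j ≡ true) where

    C : Pred (Torus ℓ) 0ℓ
    C t = ∀ i → S i ≡ true → t i ≈₁ ½₁

    entries : Fin ℓ → Entry ℓ
    entries i = if S i then half else var i

    entries∈C : ∀ t → evalAll entries t ∈ C
    entries∈C t i i∈S rewrite i∈S = ≈₁-refl {½₁}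

    entries-out : ∀ t i → S i ≡ false → evalAll entries t i ≡ t i
    entries-out t i i∉S rewrite i∉S = refl

    C-pair : ∀ σ {i j} → S i ≡ true → S j ≡ true → C ⊆ Pair σ i j
    C-pair σ {i} {j} i∈S j∈S {t} t∈C = pair-½½ σ {t i} {t j} (t∈C i i∈S) (t∈C j j∈S)

    C-connected : Connected C
    C-connected = evalAll-connected entries entries∈C fixed
      where
      fixed : ∀ t → t ∈ C → evalAll entries t ≋ t
      fixed t t∈C i with S i in eq
      ... | true  = ≈₁-sym {t i} {½₁} (t∈C i eq)
      ... | false = ≈₁-refl {t i}

    layer : Layer H
    layer = component C (evalAll entries ones , entries∈C ones) C-connected λ D D-conn C⊆D D⊆ {t} t∈D i i∈S →
      let j , i≢j , j∈S = partner i i∈S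
          in-pair : ∀ σ → D ⊆ Pair σ i j
          in-pair σ = λ {s} s∈D → let α , H⊆ , ⊆H = pairRoot σ i≢j in
            H⊆ (D⊆ s∈D α (λ {u} u∈C → ⊆H (C-pair σ i∈S j∈S {u} u∈C)))
          values : ∀ s → s ∈ D → s i ≈₁ 1₁ ⊎ s i ≈₁ ½₁
          values s s∈D = t²≈1⇒t≈1∨½ {s i}
            (both-pairs⇒square {s i} {s j} (in-pair true {s} s∈D) (in-pair false {s} s∈D))
          c∈D = C⊆D {evalAll entries ones} (entries∈C ones)
      -- The point `evalAll entries ones` of `D` has `i`-th coordinate -1, which rules out the value
      -- 1.
      in [ (λ t≈1 → ⊥-elim (two-valued⇒constant D-conn i values {t} {evalAll entries ones}
                              t∈D t≈1 c∈D (entries∈C ones i i∈S))) , id ]′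
           (values t t∈D)

-- Dimension at least three

third : ∀ {ℓ} → 3 ≤ ℓ → (i k : Fin ℓ) → ∃[ m ] i ≢ m × k ≢ m
third (ℕ.s≤s (ℕ.s≤s (ℕ.s≤s _))) = go
  where
  go : ∀ {n} (i k : Fin (3 ℕ.+ n)) → ∃[ m ] i ≢ m × k ≢ m
  go Fin.zero              Fin.zero              = Fin.suc Fin.zero , (λ ()) , λ ()
  go Fin.zero              (Fin.suc Fin.zero)    = Fin.suc (Fin.suc Fin.zero) , (λ ()) , λ ()
  go Fin.zero              (Fin.suc (Fin.suc _)) = Fin.suc Fin.zero , (λ ()) , λ ()
  go (Fin.suc Fin.zero)    Fin.zero              = Fin.suc (Fin.suc Fin.zero) , (λ ()) , λ ()
  go (Fin.suc (Fin.suc _)) Fin.zero              = Fin.suc Fin.zero , (λ ()) , λ ()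
  go (Fin.suc _)           (Fin.suc _)           = Fin.zero , (λ ()) , λ ()

module ModularMeetB (em : ExcludedMiddle (suc 0ℓ)) (ℓ : ℕ) (3≤ℓ : 3 ≤ ℓ) where
  open LayersB ℓ

  Meets : Layer H → Layer H → Set₁
  Meets x y = ∀ o a w → Minimum _⊑_ o → o ⊏ a → a ⊏ w → w ⊑ x → ∃[ v ] v ⊑ y × v ⊑ w × ¬ v ⊑ o

  i₀ : Fin ℓ
  i₀ = Fin.fromℕ< (ℕₚ.≤-trans (ℕ.s≤s ℕ.z≤n) 3≤ℓ)

  meet-root : ∀ {y w} → ∃[ v ] v ⊑ y × v ⊑ w × ¬ v ⊑ whole → ∃[ α ] points y ⊆ H α × points w ⊆ H α
  meet-root {y} {w} (v , v⊑y , v⊑w , v⋢whole) with em₀ em {∃[ α ] α ∈ Layer.subset v}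
  ... | yes (α , α∈) = α , (λ t∈y → ∈H v α α∈ (v⊑y t∈y)) , (λ t∈w → ∈H v α α∈ (v⊑w t∈w))
  ... | no  none     = ⊥-elim (v⋢whole λ {t} _ → subset-empty⇒bottom v (λ α α∈ → none (α , α∈)) t)

  Line : Fin ℓ → Pred (Torus ℓ) 0ℓ
  Line k t = ∀ i → i ≢ k → t i ≈₁ 1₁

  -- If t k = 1 fails on y, then for i, m ≠ k the subtorus t k = 1, t i = t m^±1
  -- forces t i · t m^±1 = 1 on y for both signs.
  ⊆Line : ∀ y → y ⊑ origin → Meets origin y → ∃[ k ] points y ⊆ Line k
  ⊆Line y y⊑origin y-meets with em₀ em {∃[ k ] ¬ (points y ⊆ H (short k))}
  -- Here all coordinates are 1 on `y`, and any index serves as `k`.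
  ... | no none = i₀ , λ t∈y i _ → dne i t∈y
    where
    dne : ∀ i → points y ⊆ H (short i)
    dne i with em₀ em {points y ⊆ H (short i)}
    ... | yes y⊆ = y⊆
    ... | no  y⊈ = ⊥-elim (none (i , y⊈))
  ... | yes (k , y⊈) = k , λ {t} t∈y i i≢k → on-y i i≢k {t} t∈y
    where
    on-y : ∀ i → i ≢ k → ∀ {t} → t ∈ points y → t i ≈₁ 1₁
    on-y i i≢k {t} t∈y =
      -- On `y` the coordinate is ±1, and the point (1, ..., 1) of `y` selects the value 1.
      [ id , (λ t≈½ → ⊥-elim (two-valued⇒constant (IsConnectedComponent.connected (Layer.isComponent y)) i values
               {ones} {t} (y⊑origin (≋-refl {t = ones})) (≈₁-refl {1₁}) t∈y t≈½)) ]′ (values t t∈y)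
      where
      m = proj₁ (third 3≤ℓ i k)
      i≢m = proj₁ (proj₂ (third 3≤ℓ i k))
      k≢m = proj₂ (proj₂ (third 3≤ℓ i k))
      y⊆pair : ∀ σ → points y ⊆ Pair σ i m
      y⊆pair σ = conclude (meet-root {y} {layer} (y-meets
          whole (hyperplane (short k)) layer whole-min (whole⊏hyperplane (short k)) hyperplane⊏layer (λ {t} → layer⊑origin {t})))
        where
        open ShortPair σ (i≢k ∘ sym) k≢m i≢m
        conclude : ∃[ α ] points y ⊆ H α × C ⊆ H α → points y ⊆ Pair σ i m
        conclude (α , y⊆ , C⊆) with roots α C⊆
        ... | inj₁ ⊆short = ⊥-elim (y⊈ (λ {s} s∈y → ⊆short (y⊆ s∈y)))
        ... | inj₂ ⊆pair  = ⊆pair ∘ y⊆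
      values : ∀ s → s ∈ points y → s i ≈₁ 1₁ ⊎ s i ≈₁ ½₁
      values s s∈y = t²≈1⇒t≈1∨½ {s i}
        (both-pairs⇒square {s i} {s m} (y⊆pair true {s} s∈y) (y⊆pair false {s} s∈y))

  module Q = Half (λ _ → true) (λ i _ →
    proj₁ (third 3≤ℓ i i) , proj₁ (proj₂ (third 3≤ℓ i i)) , refl)

  Q-maximal : IsMaximal (layers H) U Q.layer
  Q-maximal = singleton-maximal Q.layer λ {t} {s} p q i →
    ≈₁-trans {t i} {½₁} {s i} (p i refl) (≈₁-sym {s i} {½₁} (q i refl))

  module _ {k j : Fin ℓ} (k≢j : k ≢ j) where

    inKJ : Fin ℓ → Bool
    inKJ = ((λ _ → false) [ k ↦ true ]) [ j ↦ true ]

    k∈ : inKJ k ≡ true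
    k∈ = trans (update-≢ _ true (k≢j ∘ sym)) (update-≡ _ k true)

    j∈ : inKJ j ≡ true
    j∈ = update-≡ _ j true

    ∉KJ : ∀ {m} → k ≢ m → j ≢ m → inKJ m ≡ false
    ∉KJ k≢m j≢m = trans (update-≢ _ true j≢m) (update-≢ _ true k≢m)

    KJ-partner : ∀ i → inKJ i ≡ true → ∃[ m ] i ≢ m × inKJ m ≡ true
    KJ-partner i _ with i Finₚ.≟ k
    ... | yes refl = j , k≢j , j∈
    ... | no i≢k   = k , i≢k , k∈

    module R = Half inKJ KJ-partner

    -- Short roots fail at (-1, ..., -1). A pair with an index `b` outside `k`, `j` fails at a point
    -- with -1 at the other index and 1 at `b`. Both signs of the pair `k`, `j` survive.
    R-roots : ∀ α → R.C ⊆ H α → ∃[ τ ] H α ⊆ Pair τ k j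
    R-roots α R⊆ with rootView α
    ... | isShort m refl = ⊥-elim (½₁≉1₁ (R⊆ {½s} (λ _ _ → ≈₁-refl {½₁})))
    ... | isPair τ a b a≢b H⊆ = go (k Finₚ.≟ a) (k Finₚ.≟ b) (j Finₚ.≟ a) (j Finₚ.≟ b)
      where
      split : ∀ t a b → t ∈ Pair τ a b → t a ≈₁ ½₁ → t b ≈₁ 1₁ → ⊥
      split t a b tab ta≈½ tb≈1 = ½₁≉1₁ (≈₁-trans {½₁} {t a} {1₁} (≈₁-sym {t a} {½₁} ta≈½)
        (pair-cancelʳ τ {t a} {t b} tab tb≈1))
      mixed : ∀ a b → R.C ⊆ Pair τ a b → a ≢ b → k ≢ b → j ≢ b → ⊥
      mixed a b R⊆ a≢b k≢b j≢b = split t a b (R⊆ {t} t∈) ta≈½ tb≈1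
        where
        v = ones [ a ↦ ½₁ ]
        t = evalAll R.entries v
        t∈ = R.entries∈C v
        tb≈1 : t b ≈₁ 1₁
        tb≈1 = ≡⇒≈₁ (trans (R.entries-out v b (∉KJ k≢b j≢b)) (update-≢ ones ½₁ a≢b))
        ta≈½ : t a ≈₁ ½₁
        ta≈½ with inKJ a in eq
        ... | true  = ≈₁-refl {½₁}
        ... | false = ≡⇒≈₁ (update-≡ ones a ½₁)
      R⊆ab : R.C ⊆ Pair τ a b
      R⊆ab {t} t∈ = H⊆ (R⊆ {t} t∈)
      R⊆ba : R.C ⊆ Pair τ b a
      R⊆ba {t} t∈ = Pair-sym τ a b {t} (R⊆ab {t} t∈)
      go : Dec (k ≡ a) → Dec (k ≡ b) → Dec (j ≡ a) → Dec (j ≡ b) → ∃[ τ ] H α ⊆ Pair τ k j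
      go (yes refl) _ _ (yes refl) = τ , H⊆
      go _ (yes refl) (yes refl) _ = τ , λ {t} p → Pair-sym τ j k {t} (H⊆ p)
      go _ (no k≢b) _ (no j≢b) = ⊥-elim (mixed a b R⊆ab a≢b k≢b j≢b)
      go (no k≢a) _ (no j≢a) _ = ⊥-elim (mixed b a R⊆ba (a≢b ∘ sym) k≢a j≢a)
      go (yes refl) (yes refl) _ _ = ⊥-elim (a≢b refl)
      go _ _ (yes refl) (yes refl) = ⊥-elim (a≢b refl)

    -- The hypertorus only serves as the middle of the chain certifying that `R.layer` has rank at
    -- least two.
    KJ-root = pairRoot true k≢j
    β = proj₁ KJ-root

    hyperplane⊏R : hyperplane β ⊏ R.layer
    hyperplane⊏R = (λ {t} t∈ → proj₂ (proj₂ KJ-root) (R.C-pair true k∈ j∈ {t} t∈)) , λ eq →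
      ½₁≉1₁ (≈₁-sym {1₁} {½₁}
        (⊑-reflexive {R.layer} {hyperplane β} (≅.sym {hyperplane β} {R.layer} eq) {ones} (ones∈H β) k k∈))

    -- The maximal modular element below the point (−1, …, −1) meets t k = t j = −1,
    -- whose only hyperplanes are those of ε k ± ε j.
    meets-half : ∀ z → Meets Q.layer z → ∃[ α ] points z ⊆ H α × ∃[ τ ] H α ⊆ Pair τ k j
    meets-half z z-meets =
      let α , z⊆ , R⊆ = meet-root {z} {R.layer}
            (z-meets whole (hyperplane β) R.layer whole-min (whole⊏hyperplane β) hyperplane⊏R (λ {t} t∈ i _ → t∈ i refl))
      in α , z⊆ , R-roots α R⊆

-- The contradiction between the two points

module _ (em : ExcludedMiddle (suc 0ℓ)) (ℓ : ℕ) (3≤ℓ : 3 ≤ ℓ) where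
  open LayersB ℓ
  open ModularMeetB em ℓ 3≤ℓ
  open ModularMeet em (layers H)

  no-topIdeal : ¬ TopIdeal
  no-topIdeal topId = proper all∈ideal
    where
    open TopIdeal topId

    origin-maximal : IsMaximal (layers H) U origin
    origin-maximal = singleton-maximal origin λ {t} {s} p q → ≋-trans {t = t} {s = ones} {u = s} p (≋-sym {t = s} {s = ones} q)

    -- The line gives `t j = 1`, and then the pair relation gives `t k = 1` for either sign; this is
    -- why `τ` may remain unknown.
    origin∈ideal : ∀ y → y ∈ ideal → y ⊑ origin → ∀ {k} → points y ⊆ Line k →
                   ∀ {j} → k ≢ j → ∀ α → hyperplane α ∈ ideal → ∀ τ → H α ⊆ Pair τ k j → origin ∈ ideal
    origin∈ideal y y∈ideal y⊑origin {k} y⊆line {j} k≢j γ γ∈ideal τ γ⊆pair = joinClosed T T⊆ideal origin (origin-ub , origin-min)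
      where
      T : Pred (Layer H) 0ℓ
      T z = z ⊑ y ⊎ z ⊑ hyperplane γ
      T⊆ideal : T ⊆ ideal
      T⊆ideal {z} (inj₁ z⊑y) = downClosed {z} {y} z⊑y y∈ideal
      T⊆ideal {z} (inj₂ z⊑h) = downClosed {z} {hyperplane γ} z⊑h γ∈ideal
      origin-ub : IsUpperBound (layers H) T origin
      origin-ub z (inj₁ z⊑y) = ⊑-trans {z} {y} {origin} z⊑y y⊑origin
      origin-ub z (inj₂ z⊑h) = ⊑-trans {z} {hyperplane γ} {origin} z⊑h (hyperplane⊑origin γ)
      origin-min : ∀ v → IsUpperBound (layers H) T v → v ⊑ origin → v ≅ origin
      origin-min v v-ub v⊑origin = ⊑-antisym {v} {origin} v⊑origin λ {t} t∈v i → coordinate t t∈v i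
        where
        coordinate : ∀ t → t ∈ points v → ∀ i → t i ≈₁ 1₁
        coordinate t t∈v i with i Finₚ.≟ k
        ... | no i≢k   = y⊆line (v-ub y (inj₁ (⊑-refl {y})) t∈v) i i≢k
        ... | yes refl = pair-cancelʳ τ {t k} {t j}
          (γ⊆pair (v-ub (hyperplane γ) (inj₂ (⊑-refl {hyperplane γ})) t∈v))
          (y⊆line (v-ub y (inj₁ (⊑-refl {y})) t∈v) j (k≢j ∘ sym))

    -- Every layer is a minimal upper bound of the hyperplanes defining it.
    generated : origin ∈ ideal → ∀ X → X ∈ ideal
    generated origin∈ X = joinClosed T T⊆ideal X
      ((λ z (α , α∈ , z⊑) {t} t∈X → z⊑ (∈H X α α∈ t∈X)) , X-min)
      where
      T : Pred (Layer H) 0ℓ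
      T z = ∃[ α ] α ∈ Layer.subset X × z ⊑ hyperplane α
      T⊆ideal : T ⊆ ideal
      T⊆ideal {z} (α , _ , z⊑) = downClosed {z} {origin}
        (⊑-trans {z} {hyperplane α} {origin} z⊑ (hyperplane⊑origin α)) origin∈
      X-min : ∀ v → IsUpperBound (layers H) T v → v ⊑ X → v ≅ X
      X-min v v-ub v⊑X = ⊑-antisym {v} {X} v⊑X
        (IsConnectedComponent.maximal (Layer.isComponent X) (points v)
          (IsConnectedComponent.connected (Layer.isComponent v)) v⊑X
          (λ {t} t∈v α α∈ → v-ub (hyperplane α) (α , α∈ , ⊑-refl {hyperplane α}) t∈v))

    all∈ideal : ∀ X → X ∈ ideal
    all∈ideal =
      let y , y∈ideal , y⊑origin , y-meets = meets origin origin-maximal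
          k , y⊆line = ⊆Line y y⊑origin y-meets
          -- The index `k` is dictated by the point (1, ..., 1); only then is the test at (-1, ...,
          -- -1) aimed at a pair containing `k`.
          j , k≢j , _ = third 3≤ℓ k k
          z , z∈ideal , _ , z-meets = meets Q.layer Q-maximal
          α , z⊆ , τ , α⊆ = meets-half k≢j z z-meets
      in generated (origin∈ideal y y∈ideal y⊑origin y⊆line k≢j α
           (downClosed {hyperplane α} {z} z⊆ z∈ideal) τ α⊆)

  not-supersolvable : ¬ Supersolvable (layers H)
  not-supersolvable ss = no-topIdeal (topIdeal ss (origin , λ min → ½₁≉1₁ (min whole {½s} tt i₀)))

-- Dimension at most two

rank-0 : (P : Poset c ℓ₁ ℓ₂) → ∀ {o} → Minimum (Poset._≤_ P) o → ∀ x → Poset._≈_ P x o → HasRank (P ↓ x) 0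
rank-0 P {o} o-min x x≈o = ((x , refl⊑) ∷ [] , [-] , refl) ,
  chain-length≤1 {P = P ↓ x} λ {y} {z} y⊑z →
    antisym y⊑z (⊑-trans (proj₂ z) (⊑-trans (reflexive x≈o) (o-min (proj₁ y))))
  where open Poset P using (_≈_; antisym; reflexive; module Eq) renaming (_≤_ to _⊑ᴾ_; refl to refl⊑; trans to ⊑-trans)

rank-1 : (P : Poset c ℓ₁ ℓ₂) → let open Poset P using (_≈_) renaming (_≤_ to _⊑_) in
         ∀ {o d} → Minimum _⊑_ o → ¬ d ⊑ o → (∀ {x} → x ⊑ d → x ≈ o ⊎ x ≈ d) →
         ∀ x → x ≈ d → HasRank (P ↓ x) 1
rank-1 P {o} {d} o-min d⋢o below-d x x≈d =
  ((o , o-min x) ∷ (x , refl⊑) ∷ [] ,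
   (o-min x , λ o≈x → d⋢o (reflexive (Eq.sym (Eq.trans o≈x x≈d)))) ∷ [-] , refl) ,
  chain-length≤2 {P = P ↓ x} (λ {u} {v} {w} → bound {u} {v} {w})
  where
  open Poset P using (_≈_; antisym; reflexive; module Eq) renaming (_≤_ to _⊑ᴾ_; refl to refl⊑; trans to ⊑-trans)
  bound : ∀ {u v w : Poset.Carrier (P ↓ x)} → proj₁ u ⊑ᴾ proj₁ v → proj₁ v ⊑ᴾ proj₁ w →
          proj₁ u ≈ proj₁ v ⊎ proj₁ v ≈ proj₁ w
  bound {u , _} {v , v⊑x} {w , w⊑x} u⊑v v⊑w with below-d (⊑-trans v⊑x (reflexive x≈d))
  ... | inj₁ v≈o = inj₁ (antisym u⊑v (⊑-trans (reflexive v≈o) (o-min u)))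
  ... | inj₂ v≈d = inj₂ (antisym v⊑w (⊑-trans w⊑x (reflexive (Eq.trans x≈d (Eq.sym v≈d)))))

bottom-mIdeal : ExcludedMiddle (suc 0ℓ) → (R : Poset (suc 0ℓ) 0ℓ 0ℓ) →
  let open Poset R using (Carrier) renaming (_≤_ to _⊑_) in
  ∀ o → Minimum _⊑_ o → HeightTwo R o → IsMIdeal R (λ x → x ⊑ o)
bottom-mIdeal em R o o-min height = principal-mIdeal em R o o-min height o
  (λ {x} x⊑o → inj₁ (antisym x⊑o (o-min x))) 0 (rank-0 R o-min)
  (λ x _ _ → x , refl⊑ , o-min x , λ v x⊑v _ _ → x⊑v)
  (λ x _ → o-min x)
  where open Poset R using (antisym) renaming (refl to refl⊑)

module _ (ℓ : ℕ) where
  open LayersB ℓ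

  origin-maximal : ∀ Y → origin ⊑ Y → Y ≅ origin
  origin-maximal Y = proj₂ (singleton-maximal origin λ {t} {s} p q →
    ≋-trans {t = t} {s = ones} {u = s} p (≋-sym {t = s} {s = ones} q)) Y tt

  ≅origin⇒maximal : ∀ Y Z → Y ≅ origin → Y ⊑ Z → Y ≅ Z
  ≅origin⇒maximal Y Z Y≅origin Y⊑Z = ≅.trans {Y} {origin} {Z} Y≅origin (≅.sym {Z} {origin} (origin-maximal Z
    λ {t} t∈Z → ⊑-reflexive {origin} {Y} (≅.sym {Y} {origin} Y≅origin) {t} (Y⊑Z t∈Z)))

  ⊑whole⇒min : ∀ X → X ⊑ whole ⇔ Minimum _⊑_ X
  ⊑whole⇒min X = mk⇔ {A = X ⊑ whole} {B = Minimum _⊑_ X}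
    (λ X⊑whole Y → ⊑-trans {X} {whole} {Y} X⊑whole (whole-min Y)) (λ min → min whole)

  origin⋢whole : Fin ℓ → ¬ origin ⊑ whole
  origin⋢whole i p = ½₁≉1₁ (p {½s} tt i)

  whole⊏origin : Fin ℓ → whole ⊏ origin
  whole⊏origin i = (λ _ → tt) , λ eq →
    origin⋢whole i (λ {t} → ⊑-reflexive {origin} {whole} (≅.sym {whole} {origin} eq) {t})

  ⋢whole⇒root : ExcludedMiddle (suc 0ℓ) → ∀ X → X ≅ whole ⊎ ∃[ α ] α ∈ Layer.subset X
  ⋢whole⇒root em X with em₀ em {∃[ α ] α ∈ Layer.subset X}
  ... | yes root = inj₂ root
  ... | no  none = inj₁ (⊑-antisym {X} {whole}
    (λ {t} _ → subset-empty⇒bottom X (λ α α∈ → none (α , α∈)) t) (whole-min X))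

module _ (em : ExcludedMiddle (suc 0ℓ)) where

  supersolvable₁ : Supersolvable (layers (arrangementB 1))
  supersolvable₁ = record
    { r      = 1
    ; ideal  = ideal
    ; bottom = ⊑whole⇒min 1
    ; top    = λ _ → tt
    ; strict = λ where Fin.zero → (λ _ → tt) , λ all → origin⋢whole 1 Fin.zero (λ {t} → all {origin} tt {t})
    ; mIdeal = λ where Fin.zero → bottom-mIdeal em (layers H ↾ (λ _ → ⊤)) (whole , tt) (λ x → whole-min (proj₁ x))
                                    (λ {x} {y} {z} → height {proj₁ x} {proj₁ y} {proj₁ z})
    ; rank   = λ where
        Fin.zero           → rank-0 (layers H) {whole} whole-min whole (≅.refl {whole})
        (Fin.suc Fin.zero) →
          ((whole , tt) ∷ (origin , tt) ∷ [] ,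
            whole⊏origin 1 Fin.zero ∷ [-] , refl) ,
          chain-length≤2 {P = layers H ↾ (λ _ → ⊤)} λ {x} {y} {z} → bound (proj₁ x) (proj₁ y) (proj₁ z)
    }
    where
    open LayersB 1

    ideal : Fin 2 → Pred (Layer H) 0ℓ
    ideal Fin.zero           X = X ⊑ whole
    ideal (Fin.suc Fin.zero) X = ⊤

    H⊆origin : ∀ α {t} → t ∈ H α → t ≋ ones
    H⊆origin (short Fin.zero) p Fin.zero = p
    H⊆origin (plus Fin.zero Fin.zero ())
    H⊆origin (minus Fin.zero Fin.zero ())

    classify : ∀ X → X ≅ whole ⊎ X ≅ origin
    classify X with ⋢whole⇒root 1 em X
    ... | inj₁ X≅whole  = inj₁ X≅whole
    ... | inj₂ (α , α∈) = inj₂ (origin-maximal 1 X λ {t} t∈X → H⊆origin α {t} (∈H X α α∈ t∈X))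

    height : HeightTwo (layers H) whole
    height {x} {y} {z} y⊑z z⊑x with classify y
    ... | inj₁ y≅whole  = inj₁ y≅whole
    ... | inj₂ y≅origin = inj₂ (inj₂ (≅origin⇒maximal 1 y z y≅origin y⊑z))

    bound : ∀ x y z → x ⊑ y → y ⊑ z → x ≅ y ⊎ y ≅ z
    bound x y z x⊑y y⊑z with classify y
    ... | inj₁ y≅whole  = inj₁ (⊑-antisym {x} {y} x⊑y
      (⊑-trans {y} {whole} {x} (⊑-reflexive {y} {whole} y≅whole) (whole-min x)))
    ... | inj₂ y≅origin = inj₂ (≅origin⇒maximal 1 y z y≅origin y⊑z)

-- The arrangement in the two-dimensional torus

module PlaneB (em : ExcludedMiddle (suc 0ℓ)) where
  open LayersB 2

  pattern 0F = Fin.zero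
  pattern 1F = Fin.suc Fin.zero
  pattern 2F = Fin.suc (Fin.suc Fin.zero)
  pattern 3F = Fin.suc (Fin.suc (Fin.suc Fin.zero))

  -- An index for the four hypertori free of the order proofs inside roots, so that equality is
  -- decidable and case analysis finite.
  Curve : Fin 4 → Pred (Torus 2) 0ℓ
  Curve 0F t = t 0F ≈₁ 1₁
  Curve 1F t = t 1F ≈₁ 1₁
  Curve 2F   = Pair true 0F 1F
  Curve 3F   = Pair false 0F 1F

  kind : PositiveRootB 2 → Fin 4
  kind (short 0F)   = 0F
  kind (short 1F)   = 1F
  kind (plus _ _ _) = 2F
  kind (minus _ _ _) = 3F

  H⊆Curve : ∀ α → H α ⊆ Curve (kind α)
  H⊆Curve (short 0F)      p = p
  H⊆Curve (short 1F)      p = p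
  H⊆Curve (plus 0F 1F _)  p = p
  H⊆Curve (minus 0F 1F _) p = p
  H⊆Curve (plus 0F 0F ())
  H⊆Curve (plus 1F 0F ())
  H⊆Curve (plus 1F 1F (ℕ.s≤s ()))
  H⊆Curve (minus 0F 0F ())
  H⊆Curve (minus 1F 0F ())
  H⊆Curve (minus 1F 1F (ℕ.s≤s ()))

  Curve⊆H : ∀ α → Curve (kind α) ⊆ H α
  Curve⊆H (short 0F)      p = p
  Curve⊆H (short 1F)      p = p
  Curve⊆H (plus 0F 1F _)  p = p
  Curve⊆H (minus 0F 1F _) p = p
  Curve⊆H (plus 0F 0F ())
  Curve⊆H (plus 1F 0F ())
  Curve⊆H (plus 1F 1F (ℕ.s≤s ()))
  Curve⊆H (minus 0F 0F ())
  Curve⊆H (minus 1F 0F ())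
  Curve⊆H (minus 1F 1F (ℕ.s≤s ()))

  -- A point on two of the curves is (1, 1) or (-1, -1), and both pair characters are trivial at
  -- either. This is what singles out `t₁t₂ = 1` as a curve through every intersection point.
  two-curves : ∀ a b → a ≢ b → ∀ t → t ∈ Curve a → t ∈ Curve b → t ∈ Curve 2F × t ∈ Curve 3F
  two-curves a b a≢b t = go a b a≢b
    where
    x = t 0F
    y = t 1F
    at-1 : x ≈₁ 1₁ → y ≈₁ 1₁ → t ∈ Curve 2F × t ∈ Curve 3F
    at-1 x≈1 y≈1 = pair-11 true {x} {y} x≈1 y≈1 , pair-11 false {x} {y} x≈1 y≈1
    go : ∀ a b → a ≢ b → t ∈ Curve a → t ∈ Curve b → t ∈ Curve 2F × t ∈ Curve 3F
    go 0F 0F ne _ _ = ⊥-elim (ne refl)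
    go 0F 1F _  p q = at-1 p q
    go 0F 2F _  p q = at-1 p (pair-cancelˡ true {x} {y} q p)
    go 0F 3F _  p q = at-1 p (pair-cancelˡ false {x} {y} q p)
    go 1F 0F _  p q = at-1 q p
    go 1F 1F ne _ _ = ⊥-elim (ne refl)
    go 1F 2F _  p q = at-1 (pair-cancelʳ true {x} {y} q p) p
    go 1F 3F _  p q = at-1 (pair-cancelʳ false {x} {y} q p) p
    go 2F 0F _  p q = at-1 q (pair-cancelˡ true {x} {y} p q)
    go 2F 1F _  p q = at-1 (pair-cancelʳ true {x} {y} p q) q
    go 2F 2F ne _ _ = ⊥-elim (ne refl)
    go 2F 3F _  p q = p , q
    go 3F 0F _  p q = at-1 q (pair-cancelˡ false {x} {y} p q)
    go 3F 1F _  p q = at-1 (pair-cancelʳ false {x} {y} p q) q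
    go 3F 2F _  p q = q , p
    go 3F 3F ne _ _ = ⊥-elim (ne refl)

  in-two-curves⇒constant : ∀ {C : Pred (Torus 2) 0ℓ} → Connected C →
    ∀ a b → a ≢ b → C ⊆ Curve a → C ⊆ Curve b → ∀ {t s} → t ∈ C → s ∈ C → t ≋ s
  in-two-curves⇒constant {C} conn a b a≢b C⊆a C⊆b {t} {s} t∈C s∈C i =
    agree (values i t t∈C) (values i s s∈C)
    where
    values : ∀ i u → u ∈ C → u i ≈₁ 1₁ ⊎ u i ≈₁ ½₁
    values i u u∈C = t²≈1⇒t≈1∨½ {u i} (square i)
      where
      curves = two-curves a b a≢b u (C⊆a u∈C) (C⊆b u∈C)
      square : ∀ i → u i · u i ≈₁ 1₁
      square 0F = both-pairs⇒square {u 0F} {u 1F} (proj₁ curves) (proj₂ curves)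
      square 1F = both-pairs⇒square {u 1F} {u 0F}
        (pair-sym true {u 0F} {u 1F} (proj₁ curves)) (pair-sym false {u 0F} {u 1F} (proj₂ curves))
    agree : t i ≈₁ 1₁ ⊎ t i ≈₁ ½₁ → s i ≈₁ 1₁ ⊎ s i ≈₁ ½₁ → t i ≈₁ s i
    agree (inj₁ p) (inj₁ q) = ≈₁-trans {t i} {1₁} {s i} p (≈₁-sym {s i} {1₁} q)
    agree (inj₁ p) (inj₂ q) = ⊥-elim (two-valued⇒constant conn i (values i) {t} {s} t∈C p s∈C q)
    agree (inj₂ p) (inj₁ q) = ⊥-elim (two-valued⇒constant conn i (values i) {s} {t} s∈C q t∈C p)
    agree (inj₂ p) (inj₂ q) = ≈₁-trans {t i} {½₁} {s i} p (≈₁-sym {s i} {½₁} q)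

  -- If all roots defining `X` give the same curve, the connected curve itself is admissible in the
  -- maximality of `X`.
  one-root⇒⊑hyperplane : ∀ X α → points X ⊆ H α →
    ¬ (∃[ β ] β ∈ Layer.subset X × kind α ≢ kind β) → X ⊑ hyperplane α
  one-root⇒⊑hyperplane X α X⊆ none = IsConnectedComponent.maximal (Layer.isComponent X)
    (H α) (hyperplane-connected α) X⊆ inside
    where
    inside : H α ⊆ Intersection H (Layer.subset X)
    inside {t} t∈ β β∈ with kind α Finₚ.≟ kind β
    ... | yes eq = Curve⊆H β {t} (subst (λ a → t ∈ Curve a) eq (H⊆Curve α {t} t∈))
    ... | no  ne = ⊥-elim (none (β , β∈ , ne))

  layer-connected : (X : Layer H) → Connected (points X)
  layer-connected X = IsConnectedComponent.connected (Layer.isComponent X)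

  -- Once `y` lies on a curve, `z` either uses a second curve, and is then a point and maximal, or
  -- is that same curve.
  height : HeightTwo (layers H) whole
  height {x} {y} {z} y⊑z z⊑x with ⋢whole⇒root 2 em y
  ... | inj₁ y≅whole = inj₁ y≅whole
  ... | inj₂ (α , α∈) with em₀ em {∃[ β ] β ∈ Layer.subset z × kind α ≢ kind β}
  ...   | yes (β , β∈ , ne) = inj₂ (inj₁ (≅.sym {x} {z} (proj₂ (singleton-maximal z
            (in-two-curves⇒constant (layer-connected z) (kind α) (kind β) ne
              (λ {t} t∈z → H⊆Curve α {t} (∈H y α α∈ (y⊑z t∈z)))
              (λ {t} t∈z → H⊆Curve β {t} (∈H z β β∈ t∈z)))) x tt z⊑x)))
  ...   | no none = inj₂ (inj₂ (⊑-antisym {y} {z} y⊑z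
            (⊑-trans {z} {hyperplane α} {y}
              (one-root⇒⊑hyperplane z α (λ t∈z → ∈H y α α∈ (y⊑z t∈z)) none) (∈H y α α∈))))

  δ : PositiveRootB 2
  δ = plus 0F 1F (ℕ.s≤s ℕ.z≤n)

  D : Layer H
  D = hyperplane δ

  ½½∈D : ∀ t → t 0F ≈₁ ½₁ → t 1F ≈₁ ½₁ → t ∈ points D
  ½½∈D t = pair-½½ true {t 0F} {t 1F}

  origin⋢D : ¬ origin ⊑ D
  origin⋢D p = ½₁≉1₁ (p {½s} (½½∈D ½s (≈₁-refl {½₁}) (≈₁-refl {½₁})) 0F)

  D⊏origin : D ⊏ origin
  D⊏origin = (λ {t} → hyperplane⊑origin δ {t}) ,
    λ eq → origin⋢D (λ {t} → ⊑-reflexive {origin} {D} (≅.sym {D} {origin} eq) {t})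

  D⋢whole : ¬ D ⊑ whole
  D⋢whole p = H-proper δ (λ t → p {t} tt)

  below-D : ∀ {X} → X ⊑ D → X ≅ whole ⊎ X ≅ D
  below-D {X} X⊑D =
    [ inj₁ , [ (λ D≅origin → ⊥-elim (proj₂ D⊏origin D≅origin)) , inj₂ ]′ ]′
      (height {origin} {X} {D} X⊑D (λ {t} → hyperplane⊑origin δ {t}))

  -- A layer cut out by at most one curve contains (1, 1), so by maximality it is that point. Any
  -- other is an intersection point of two curves and lies on `D`.
  maximal⇒D⊑ : ∀ X → (∀ Y → X ⊑ Y → Y ≅ X) → D ⊑ X
  maximal⇒D⊑ X X-max = go (⋢whole⇒root 2 em X)
    where
    below-origin : X ⊑ origin → D ⊑ X
    below-origin X⊑origin = ⊑-trans {D} {origin} {X} (λ {t} → hyperplane⊑origin δ {t})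
      (⊑-reflexive {origin} {X} (X-max origin X⊑origin))
    go : X ≅ whole ⊎ ∃[ α ] α ∈ Layer.subset X → D ⊑ X
    go (inj₁ X≅whole) = below-origin (⊑-trans {X} {whole} {origin} (⊑-reflexive {X} {whole} X≅whole) (λ _ → tt))
    go (inj₂ (α , α∈)) = case (em₀ em)
      where
      case : Dec (∃[ β ] β ∈ Layer.subset X × kind α ≢ kind β) → D ⊑ X
      case (yes (β , β∈ , ne)) {t} t∈X = proj₁ (two-curves (kind α) (kind β) ne t
        (H⊆Curve α {t} (∈H X α α∈ t∈X)) (H⊆Curve β {t} (∈H X β β∈ t∈X)))
      case (no none) {t} = below-origin (⊑-trans {X} {hyperplane α} {origin}
        (one-root⇒⊑hyperplane X α (∈H X α α∈) none) (λ {t} → hyperplane⊑origin α {t})) {t}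

  P : Poset _ _ _
  P = layers H ↾ (λ _ → ⊤)

  -- A second curve may meet `D` in both (1, 1) and (-1, -1), giving two minimal upper bounds; an
  -- M-ideal asks for one, and (1, 1) always lies on both curves.
  atom-join-D : ∀ X → IsAtom P (X , tt) → ¬ X ⊑ D →
                X ⊑ origin × (∀ V → X ⊑ V → D ⊑ V → V ⊑ origin → origin ⊑ V)
  atom-join-D X ((o , _) , o-min , o⊏X , atom) X⋢D with ⋢whole⇒root 2 em X
  ... | inj₁ X≅whole = ⊥-elim (X⋢D (⊑-trans {X} {whole} {D} (⊑-reflexive {X} {whole} X≅whole) (λ _ → tt)))
  ... | inj₂ (α , α∈) = X⊑origin , least
    where
    X⊑Hα : X ⊑ hyperplane α
    -- Otherwise the hypertorus would lie strictly between the minimum and the atom `X`.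
    X⊑Hα with em₀ em {X ⊑ hyperplane α}
    ... | yes p = p
    ... | no ¬p = ⊥-elim (atom (hyperplane α , tt)
      (o-min (hyperplane α , tt) , λ eq → H-proper α λ t →
        ⊑-trans {hyperplane α} {o} {whole} (⊑-reflexive {hyperplane α} {o} (≅.sym {o} {hyperplane α} eq))
          (o-min (whole , tt)) {t} tt)
      (∈H X α α∈ , λ eq → ¬p (⊑-reflexive {X} {hyperplane α} (≅.sym {hyperplane α} {X} eq))))
    X⊑origin : X ⊑ origin
    X⊑origin = ⊑-trans {X} {hyperplane α} {origin} X⊑Hα (λ {t} → hyperplane⊑origin α {t})
    ne : kind α ≢ 2F
    ne eq = X⋢D λ {t} t∈D → X⊑Hα (Curve⊆H α {t} (subst (λ a → t ∈ Curve a) (sym eq) t∈D))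
    least : ∀ V → X ⊑ V → D ⊑ V → V ⊑ origin → origin ⊑ V
    least V X⊑V D⊑V V⊑origin {t} t∈V =
      in-two-curves⇒constant (layer-connected V) (kind α) 2F ne
        (λ {s} s∈V → H⊆Curve α {s} (∈H X α α∈ (X⊑V s∈V))) (λ {s} s∈V → D⊑V s∈V)
        {t} {ones} t∈V (V⊑origin {ones} (≋-refl {t = ones}))

  ideal : Fin 3 → Pred (Layer H) 0ℓ
  ideal 0F X = X ⊑ whole
  ideal 1F X = X ⊑ D
  ideal 2F X = ⊤

  supersolvable₂ : Supersolvable (layers H)
  supersolvable₂ = record
    { r      = 2
    ; ideal  = ideal
    ; bottom = ⊑whole⇒min 2
    ; top    = λ _ → tt
    ; strict = λ where
        0F → (λ {X} X⊑whole → ⊑-trans {X} {whole} {D} X⊑whole (λ _ → tt)) ,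
             λ all → D⋢whole (λ {t} → all {D} id {t})
        1F → (λ _ → tt) , λ all → origin⋢D (λ {t} → all {origin} tt {t})
    ; mIdeal = λ where
        0F → bottom-mIdeal em (layers H ↓ D) (whole , (λ _ → tt)) (λ x → whole-min (proj₁ x))
               (λ {x} {y} {z} → height {proj₁ x} {proj₁ y} {proj₁ z})
        1F → principal-mIdeal em P (whole , tt) (λ x → whole-min (proj₁ x))
               (λ {x} {y} {z} → height {proj₁ x} {proj₁ y} {proj₁ z})
               (D , tt) (λ {x} → below-D {proj₁ x}) 1
               (rank-1 P {whole , tt} {D , tt} (λ x → whole-min (proj₁ x)) D⋢whole (λ {x} → below-D {proj₁ x}))
               (λ x atom x⋢D → let x⊑origin , least = atom-join-D (proj₁ x) atom x⋢D in
                 (origin , tt) , x⊑origin , (λ {t} → hyperplane⊑origin δ {t}) , λ v → least (proj₁ v))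
               (λ x x-max → maximal⇒D⊑ (proj₁ x) (λ Y → proj₂ x-max (Y , tt) tt))
    ; rank   = λ where
        0F → rank-0 (layers H) {whole} whole-min whole (≅.refl {whole})
        1F → rank-1 (layers H) {whole} {D} whole-min D⋢whole (λ {X} → below-D {X}) D (≅.refl {D})
        2F → ((whole , tt) ∷ (D , tt) ∷ (origin , tt) ∷ [] ,
               whole⊏hyperplane δ ∷ D⊏origin ∷ [-] , refl) ,
             chain-length≤3 {P = P} (λ {w} {x} {y} {z} → bound (proj₁ w) (proj₁ x) (proj₁ y) (proj₁ z))
    }
    where
    bound : ∀ w x y z → w ⊑ x → x ⊑ y → y ⊑ z → w ≅ x ⊎ x ≅ y ⊎ y ≅ z
    bound w x y z w⊑x x⊑y y⊑z with height {z} {x} {y} x⊑y y⊑z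
    ... | inj₁ x≅whole      = inj₁ (⊑-antisym {w} {x} w⊑x
            (⊑-trans {x} {whole} {w} (⊑-reflexive {x} {whole} x≅whole) (whole-min w)))
    ... | inj₂ (inj₁ y≅z)   = inj₂ (inj₂ y≅z)
    ... | inj₂ (inj₂ x≅y)   = inj₂ (inj₁ x≅y)

theorem7p17 : ExcludedMiddle (suc 0ℓ) → ∀ (ℓ : ℕ) → 1 ≤ ℓ → Supersolvable (layers (arrangementB ℓ)) ⇔ (ℓ ≤ 2)
theorem7p17 em ℓ 1≤ℓ = mk⇔ to (from ℓ 1≤ℓ)
  where
  to : Supersolvable (layers (arrangementB ℓ)) → ℓ ≤ 2
  to ss with ℓ ℕₚ.≤? 2
  ... | yes ℓ≤2 = ℓ≤2
  ... | no  ℓ≰2 = ⊥-elim (not-supersolvable em ℓ (ℕₚ.≰⇒> ℓ≰2) ss)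
  from : ∀ ℓ → 1 ≤ ℓ → ℓ ≤ 2 → Supersolvable (layers (arrangementB ℓ))
  from 1 _ _ = supersolvable₁ em
  from 2 _ _ = PlaneB.supersolvable₂ em
  from (ℕ.suc (ℕ.suc (ℕ.suc _))) _ (ℕ.s≤s (ℕ.s≤s ()))
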